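{- Let $0<\epsilon\le 0.5$ and $\alpha\ge 2$. Let $\mathcal{ALG}$ be any algorithm that maintains an $\alpha$-approximate set cover for the dynamic set cover problem with (amortized or worst-case) update time $T$. Then, using $\mathcal{ALG}$ as a black box, one can maintain a $((2+\epsilon)\alpha)$-approximate set cover in (respectively amortized or worst-case) update time $T+O\left(\frac{\alpha\cdot C}{\epsilon}\right)$ and with worst-case recourse $O\left(\frac{\alpha\cdot C}{\epsilon}\right)$.
   Context: Set cover: a set system $(\mathcal{U},\mathcal{S})$ consists of a universe $\mathcal{U}$ of elements and a family $\mathcal{S}$ of $m$ sets, each set $s\in\mathcal{S}$ having a cost $\mathsf{cost}(s)\in[\frac1C,1]$, where $C\ge 1$. A subfamily $\mathcal{S}'\subseteq\mathcal{S}$ is a set cover if every element of $\mathcal{U}$ belongs to at least one set of $\mathcal{S}'$; its cost is $\mathsf{cost}(\mathcal{S}')=\sum_{s\in\mathcal{S}'}\mathsf{cost}(s)$. A set cover is $\alpha$-approximate if its cost is at most $\alpha$ times the minimum cost of a set cover of the current universe. Dynamic set cover: the family $\mathcal{S}$ is fixed (with its costs), while the universe undergoes a sequence of updates, each of which inserts or deletes one element (an inserted element comes with the list of sets of $\mathcal{S}$ containing it); at all times $|\mathcal{U}|\le n$ and every element can be covered. An algorithm maintains a solution if after every update step it holds an output set cover of the current universe; it maintains an $\alpha$-approximate set cover if that output is $\alpha$-approximate after every update step. The update time is the time needed to update the maintained solution per update step; worst-case means the maximum over all update steps, amortized means the average over the update sequence. The recourse of an update step is the number of changes to the output solution (sets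 added to or removed from it) in that step; worst-case recourse is the maximum over all update steps. The constants hidden in $O(\cdot)$ are absolute. -}

module Defs where

open import Algebra.Bundles using (CommutativeRing)
import Algebra.Properties.Semiring.Mult as Mult
open import Data.Bool.Base using (if_then_else_)
open import Data.Fin.Base using (Fin; toℕ; fromℕ<)
import Data.Fin.Properties as Fin
open import Data.List.Base using (List; []; _∷_; map; foldr; filter; length)
import Data.List.Membership.DecPropositional as DecMembership
open import Data.List.Membership.Propositional using (_∈_; _∉_)
open import Data.List.Relation.Unary.All using (All)
open import Data.List.Relation.Unary.Any using (Any)
open import Data.List.Relation.Unary.Unique.Propositional using (Unique)
open import Data.Nat.Base using (ℕ; zero; suc; _+_; _∸_; _<_)
import Data.Nat.Properties as ℕ
open import Data.Product.Base using (_×_; _,_; proj₁; proj₂; Σ-syntax; ∃-syntax)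
open import Level using (Level; _⊔_) renaming (suc to lsuc)
open import Relation.Binary.Core using (Rel)
import Relation.Binary.Construct.NonStrictToStrict as NonStrictToStrict
open import Relation.Binary.PropositionalEquality.Core using (_≢_)
open import Relation.Binary.Structures using (IsTotalOrder)
open import Relation.Nullary.Decidable using (does; yes; no; ¬?)
open import Relation.Nullary.Negation using (¬_)

-- The scalars (costs, α, ε, C, T) range over an arbitrary Archimedean ordered
-- field, of which ℝ is the intended instance.  As usual, _⁻¹ is total and its
-- value at 0# is left unspecified.

record ArchimedeanOrderedField (c ℓ₁ ℓ₂ : Level) : Set (lsuc (c ⊔ ℓ₁ ⊔ ℓ₂)) where
  field
    commutativeRing : CommutativeRing c ℓ₁

  open CommutativeRing commutativeRing public
    renaming (_+_ to infixl 6 _⊕_; _*_ to infixl 7 _⊛_; -_ to infix 8 ⊖_)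

  open Mult semiring using () renaming (_×_ to _·_)

  infix 4 _≤_
  infix 9 _⁻¹

  field
    _≤_          : Rel Carrier ℓ₂
    isTotalOrder : IsTotalOrder _≈_ _≤_
    +-monoˡ-≤    : ∀ x {y z} → y ≤ z → y ⊕ x ≤ z ⊕ x
    *-nonNeg     : ∀ {x y} → 0# ≤ x → 0# ≤ y → 0# ≤ x ⊛ y
    0≉1          : ¬ (0# ≈ 1#)
    _⁻¹          : Carrier → Carrier
    ⁻¹-inverseʳ  : ∀ x → ¬ (x ≈ 0#) → x ⊛ x ⁻¹ ≈ 1#

  fromℕ : ℕ → Carrier
  fromℕ k = k · 1#

  field
    archimedean : ∀ x → ∃[ k ] x ≤ fromℕ k

  open NonStrictToStrict _≈_ _≤_ public using () renaming (_<_ to infix 4 _≺_)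

-- A family of m sets is represented by its index type Fin m; which elements a
-- set contains is revealed by the updates.  Elements are named by numbers.

Universe : ℕ → Set
Universe m = List (ℕ × List (Fin m))

data Update (m : ℕ) : Set where
  insert : (e : ℕ) (containing : List (Fin m)) → Update m
  delete : (e : ℕ) → Update m

module _ {m : ℕ} where

  names : Universe m → List ℕ
  names = map proj₁

  applyUpdate : Update m → Universe m → Universe m
  applyUpdate (insert e ss) U = (e , ss) ∷ U
  applyUpdate (delete e)    U = filter (λ x → ¬? (proj₁ x ℕ.≟ e)) U

  -- Legal updates of U; n bounds the size of the universe, and ss ≢ [] says
  -- that the inserted element can be covered.
  data Legal (n : ℕ) (U : Universe m) : Update m → Set where
    insert : ∀ {e ss} → e ∉ names U → Unique ss → ss ≢ [] → length U < n →
             Legal n U (insert e ss)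
    delete : ∀ {e} → e ∈ names U → Legal n U (delete e)

  -- Subfamilies are duplicate-free lists of indices.
  IsSetCover : Universe m → List (Fin m) → Set
  IsSetCover U S = Unique S × All (λ x → Any (_∈ S) (proj₂ x)) U

  changes : List (Fin m) → List (Fin m) → ℕ
  changes S S′ = length (filter (λ s → ¬? (s ∈? S′)) S)
               + length (filter (λ s → ¬? (s ∈? S)) S′)
    where open DecMembership (Fin._≟_ {m}) using (_∈?_)

-- A dynamic algorithm as seen from outside: what it does internally and how
-- its running time arises are unconstrained.

record Algorithm (a : Level) (m : ℕ) : Set (lsuc a) where
  field
    State    : Set a
    initial  : State
    update   : State → Update m → State
    time     : State → Update m → ℕ
    solution : State → List (Fin m)

module _ {a : Level} {m : ℕ} (A : Algorithm a m) (n : ℕ) where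
  open Algorithm A

  -- Execution k τ U σ: starting from the empty universe, some sequence of k
  -- legal updates processed in total time τ leads to universe U and state σ.
  data Execution : (k τ : ℕ) → Universe m → State → Set a where
    start : Execution 0 0 [] initial
    _▻_   : ∀ {k τ U σ u} → Execution k τ U σ → Legal n U u →
            Execution (suc k) (τ + time σ u) (applyUpdate u U) (update σ u)

module _ {c ℓ₁ ℓ₂ : Level} (F : ArchimedeanOrderedField c ℓ₁ ℓ₂) where
  open ArchimedeanOrderedField F

  record Costs (C : Carrier) (m : ℕ) : Set (c ⊔ ℓ₂) where
    field
      cost       : Fin m → Carrier
      cost-lower : ∀ s → C ⁻¹ ≤ cost s
      cost-upper : ∀ s → cost s ≤ 1#

    totalCost : List (Fin m) → Carrier
    totalCost S = foldr _⊕_ 0# (map cost S)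

    IsMinimumCost : Universe m → Carrier → Set (ℓ₁ ⊔ ℓ₂)
    IsMinimumCost U opt =
        (∃[ S ] IsSetCover U S × totalCost S ≈ opt)
      × (∀ S → IsSetCover U S → opt ≤ totalCost S)

    IsApproximateSetCover : Carrier → Universe m → List (Fin m) → Set (c ⊔ ℓ₁ ⊔ ℓ₂)
    IsApproximateSetCover α U S =
      IsSetCover U S × (∃[ opt ] IsMinimumCost U opt × totalCost S ≤ α ⊛ opt)

  MaintainsApproximate : ∀ {a : Level} {C : Carrier} {m : ℕ} → Costs C m → ℕ →
                         Carrier → Algorithm a m → Set (a ⊔ c ⊔ ℓ₁ ⊔ ℓ₂)
  MaintainsApproximate w n α A =
    ∀ {k τ U σ u} → Execution A n k τ U σ → Legal n U u →
    Costs.IsApproximateSetCover w α (applyUpdate u U) (solution (update σ u))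
    where open Algorithm A

  WorstCaseTime : ∀ {a : Level} {m : ℕ} → ℕ → Algorithm a m → Carrier → Set (a ⊔ ℓ₂)
  WorstCaseTime n A T =
    ∀ {k τ U σ u} → Execution A n k τ U σ → Legal n U u → fromℕ (time σ u) ≤ T
    where open Algorithm A

  AmortizedTime : ∀ {a : Level} {m : ℕ} → ℕ → Algorithm a m → Carrier → Set (a ⊔ ℓ₂)
  AmortizedTime n A T =
    ∀ {k τ U σ} → Execution A n k τ U σ → fromℕ τ ≤ fromℕ k ⊛ T

  WorstCaseRecourse : ∀ {a : Level} {m : ℕ} → ℕ → Algorithm a m → Carrier → Set (a ⊔ ℓ₂)
  WorstCaseRecourse n A r =
    ∀ {k τ U σ u} → Execution A n k τ U σ → Legal n U u →
    fromℕ (changes (solution σ) (solution (update σ u))) ≤ r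
    where open Algorithm A

-- Black-box reductions are programs for a unit-cost random access machine.
-- It has a memory of numbers (variables x y z below are addresses), registers
-- p q holding references to immutable linked lists of numbers, and an output
-- solution that is changed one set at a time.  Sets are named by their indices.
-- A program refers neither to a particular family of sets nor to a particular
-- algorithm, and it is the same for every update.  Loops are bounded by the
-- content of a memory cell, so every program terminates.

data Instruction : Set where
  const     : (x k : ℕ) → Instruction      -- M[x] := k
  move      : (x y : ℕ) → Instruction      -- M[x] := M[y]
  add sub   : (x y z : ℕ) → Instruction    -- M[x] := M[y] ± M[z], truncated at 0
  load      : (x y : ℕ) → Instruction      -- M[x] := M[M[y]]
  store     : (x y : ℕ) → Instruction      -- M[M[x]] := M[y]
  nil       : (p : ℕ) → Instruction        -- L[p] := []
  cons      : (p x q : ℕ) → Instruction    -- L[p] := M[x] ∷ L[q]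
  copy      : (p q : ℕ) → Instruction      -- L[p] := L[q]
  head      : (x p : ℕ) → Instruction      -- M[x] := first entry of L[p] (0 if none)
  tail      : (p q : ℕ) → Instruction      -- L[p] := L[q] without its first entry
  nonempty  : (x p : ℕ) → Instruction      -- M[x] := 0 if L[p] is empty, else 1
  inserting : (x : ℕ) → Instruction        -- M[x] := 1 for an insertion, 0 for a deletion
  element   : (x : ℕ) → Instruction        -- M[x] := the element being updated
  sets      : (p : ℕ) → Instruction        -- L[p] := the list coming with an insertion
  include   : (x : ℕ) → Instruction        -- add set M[x] to the output solution
  exclude   : (x : ℕ) → Instruction        -- remove set M[x] from the output solution
  forward   : Instruction                  -- let the black box process the current update
  query     : (p : ℕ) → Instruction        -- L[p] := the black box's current solution

infixr 5 _⨾_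

data Program : Set where
  skip          : Program
  ‵_            : Instruction → Program
  _⨾_           : Program → Program → Program
  ifNonzero_then_else_ : (x : ℕ) → Program → Program → Program
  repeat_times_ : (x : ℕ) → Program → Program

module Semantics {a : Level} {m : ℕ} (A : Algorithm a m) where
  open DecMembership (Fin._≟_ {m}) using (_∈?_)

  record Configuration : Set a where
    constructor configuration
    field
      memory   : ℕ → ℕ
      lists    : ℕ → List ℕ
      output   : List (Fin m)
      blackBox : Algorithm.State A

  open Configuration

  _[_↦_] : ∀ {B : Set} → (ℕ → B) → ℕ → B → ℕ → B
  (f [ i ↦ b ]) j = if does (j ℕ.≟ i) then b else f j

  setMemory : ℕ → ℕ → Configuration → Configuration
  setMemory x k γ = record γ { memory = memory γ [ x ↦ k ] }

  setList : ℕ → List ℕ → Configuration → Configuration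
  setList p l γ = record γ { lists = lists γ [ p ↦ l ] }

  headOr0 : List ℕ → ℕ
  headOr0 []      = 0
  headOr0 (k ∷ _) = k

  tailOr[] : List ℕ → List ℕ
  tailOr[] []      = []
  tailOr[] (_ ∷ l) = l

  isNonempty : List ℕ → ℕ
  isNonempty []      = 0
  isNonempty (_ ∷ _) = 1

  isInsertion : Update m → ℕ
  isInsertion (insert _ _) = 1
  isInsertion (delete _)   = 0

  elementOf : Update m → ℕ
  elementOf (insert e _) = e
  elementOf (delete e)   = e

  setsOf : Update m → List ℕ
  setsOf (insert _ ss) = map toℕ ss
  setsOf (delete _)    = []

  -- Numbers that do not name a set are ignored.
  includeSet : ℕ → List (Fin m) → List (Fin m)
  includeSet k S with k ℕ.<? m
  ... | no  _   = S
  ... | yes k<m = if does (fromℕ< k<m ∈? S) then S else fromℕ< k<m ∷ S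

  excludeSet : ℕ → List (Fin m) → List (Fin m)
  excludeSet k = filter (λ s → ¬? (toℕ s ℕ.≟ k))

  execute : Instruction → Update m → Configuration → Configuration
  execute (const x k)    u γ = setMemory x k γ
  execute (move x y)     u γ = setMemory x (memory γ y) γ
  execute (add x y z)    u γ = setMemory x (memory γ y + memory γ z) γ
  execute (sub x y z)    u γ = setMemory x (memory γ y ∸ memory γ z) γ
  execute (load x y)     u γ = setMemory x (memory γ (memory γ y)) γ
  execute (store x y)    u γ = setMemory (memory γ x) (memory γ y) γ
  execute (nil p)        u γ = setList p [] γ
  execute (cons p x q)   u γ = setList p (memory γ x ∷ lists γ q) γ
  execute (copy p q)     u γ = setList p (lists γ q) γ
  execute (head x p)     u γ = setMemory x (headOr0 (lists γ p)) γ
  execute (tail p q)     u γ = setList p (tailOr[] (lists γ q)) γ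
  execute (nonempty x p) u γ = setMemory x (isNonempty (lists γ p)) γ
  execute (inserting x)  u γ = setMemory x (isInsertion u) γ
  execute (element x)    u γ = setMemory x (elementOf u) γ
  execute (sets p)       u γ = setList p (setsOf u) γ
  execute (include x)    u γ = record γ { output = includeSet (memory γ x) (output γ) }
  execute (exclude x)    u γ = record γ { output = excludeSet (memory γ x) (output γ) }
  execute forward        u γ = record γ { blackBox = Algorithm.update A (blackBox γ) u }
  execute (query p)      u γ = setList p (map toℕ (Algorithm.solution A (blackBox γ))) γ

  -- Running the black box is charged with the black box's own time.  Reading
  -- its solution only yields a reference to a list, the delivery of which is
  -- part of the black box's update time; reading the entries of that list is
  -- charged to the program.
  instructionTime : Instruction → Update m → Configuration → ℕ
  instructionTime forward u γ = suc (Algorithm.time A (blackBox γ) u)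
  instructionTime _       u γ = 1

  loop : ℕ → (Configuration → Configuration × ℕ) → Configuration → Configuration × ℕ
  loop zero    body γ = γ , 1
  loop (suc k) body γ =
    let γ₁ , t₁ = body γ
        γ₂ , t₂ = loop k body γ₁
    in  γ₂ , suc (t₁ + t₂)

  run : Program → Update m → Configuration → Configuration × ℕ
  run skip    u γ = γ , 0
  run (‵ i)   u γ = execute i u γ , instructionTime i u γ
  run (P ⨾ Q) u γ =
    let γ₁ , t₁ = run P u γ
        γ₂ , t₂ = run Q u γ₁
    in  γ₂ , t₁ + t₂
  run (ifNonzero x then P else Q) u γ with memory γ x
  ... | suc _ = let γ₁ , t₁ = run P u γ in γ₁ , suc t₁
  ... | zero  = let γ₁ , t₁ = run Q u γ in γ₁ , suc t₁
  run (repeat x times P) u γ = loop (memory γ x) (run P u) γ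

-- The dynamic algorithm obtained by running P on each update, with A as the
-- black box.

_⟨_⟩ : ∀ {a : Level} {m : ℕ} → Program → Algorithm a m → Algorithm a m
P ⟨ A ⟩ = record
  { State    = Configuration
  ; initial  = configuration (λ _ → 0) (λ _ → []) [] (Algorithm.initial A)
  ; update   = λ γ u → proj₁ (run P u γ)
  ; time     = λ γ u → proj₂ (run P u γ)
  ; solution = Configuration.output
  }
  where open Semantics A

{-# OPTIONS --safe #-}
module Submission where

-- The output migrates between snapshots of the black box's solution.  A phase
-- takes a snapshot S, moves the sets of S one by one into the output, and then
-- discards one by one those sets of the previous phase that are not needed any
-- more; every update pays for a fixed number r = Θ(αC/ε) of such steps.  In
-- addition the output receives one set for every inserted element.
--
-- Costs being at least 1/C, a phase consists of O(αC·opt) steps, so it lasts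
-- O(ε·opt) updates, or it ends within the update that started it when opt is
-- small.  As costs are at most 1, an update decreases the optimum by at most 1.
-- Hence at any time both snapshots in use cost at most (1 + O(ε))·α·opt and the
-- sets received for insertions O(ε·opt).

open import Defs
import Algebra.Properties.CommutativeSemigroup as CommutativeSemigroup
import Algebra.Properties.Monoid.Mult as MonoidMult
import Algebra.Properties.Ring as RingProperties
import Algebra.Properties.Semiring.Mult as SemiringMult
import Algebra.Solver.Ring.NaturalCoefficients.Default as NaturalCoefficients
open import Data.Bool.Base using (if_then_else_)
open import Data.Empty using (⊥)
open import Data.Fin.Base using (Fin; toℕ; fromℕ<)
import Data.Fin.Properties as Fin
open import Data.List.Base using (List; []; _∷_; _++_; map; filter; length)
import Data.List.Membership.DecPropositional as DecMembership
open import Data.List.Membership.Propositional using (_∈_; _∉_; find; lose)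
open import Data.List.Membership.Propositional.Properties
  using (∈-∃++; ∈-++⁻; ∈-++⁺ˡ; ∈-++⁺ʳ; ∈-filter⁺; ∈-filter⁻; ∈-map⁻)
import Data.List.Properties as List
import Data.List.Relation.Binary.Sublist.Propositional as Sublist
import Data.List.Relation.Binary.Sublist.Propositional.Properties as Sublist
open import Data.List.Relation.Binary.Subset.Propositional using (_⊆_)
open import Data.List.Relation.Binary.Subset.Propositional.Properties using (++⁺ˡ; ++⁺ʳ)
open import Data.List.Relation.Unary.All as All using (All; []; _∷_)
import Data.List.Relation.Unary.All.Properties as All
open import Data.List.Relation.Unary.AllPairs using (AllPairs; []; _∷_)
import Data.List.Relation.Unary.AllPairs.Properties as AllPairs
open import Data.List.Relation.Unary.Any as Any using (Any; here; there)
open import Data.List.Relation.Unary.Unique.Propositional using (Unique)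
open import Data.Nat.Base as ℕ using (ℕ; zero; suc; z≤n; s≤s)
import Data.Nat.Properties as ℕ
open import Data.Product.Base using (_×_; _,_; proj₁; proj₂; Σ-syntax; ∃-syntax)
open import Data.Sum.Base as Sum using (_⊎_; inj₁; inj₂)
open import Data.Unit.Base using (⊤)
open import Function.Base using (_∘_; _on_)
open import Level using (Level; _⊔_)
open import Relation.Binary.Bundles using (Poset)
open import Relation.Binary.PropositionalEquality as ≡ using (_≡_; _≢_)
import Relation.Binary.Reasoning.PartialOrder as PartialOrderReasoning
open import Relation.Binary.Structures using (IsTotalOrder)
open import Relation.Nullary.Decidable using (Dec; does; yes; no; ¬?; dec-true; dec-false)
open import Relation.Nullary.Negation using (¬_; contradiction)

-- Bounding the length of a phase is circular: its work is proportional to the optimum `o` at its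
-- start, the allowance to the optimum `opt` now, and `o` may exceed `opt` by the very number of
-- updates to be bounded. With `r ≥ 12αC` the drift accounts for at most half of the steps paid for,
-- so it can be absorbed.
--
-- Additive constants are harmless because a phase that outlives its first update forces
-- `1 ≤ ζ opt`, while a phase that ends at once leaves a single snapshot whose bound `α o` has no
-- such constant.
--
-- The factor 2 comes from two snapshots being in the output together. Of the slack `6ζ`, `2ζ` is
-- what the older snapshot had already lost when its phase settled, and `4ζ` pays for the drift, the
-- sets received for insertions and the additive constants. Hence `ζ = ε/6`.
--
-- The two snapshots may share sets, and several insertions may pick the same set. A set is
-- therefore dropped only with its last occurrence, and counting costs with multiplicity can only
-- overestimate the output.

open CommutativeSemigroup ℕ.+-commutativeSemigroup using (interchange)

-- Arithmetic in an Archimedean ordered field.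

module OrderedField {c ℓ₁ ℓ₂ : Level} (F : ArchimedeanOrderedField c ℓ₁ ℓ₂) where
  open ArchimedeanOrderedField F hiding (zero)
  open IsTotalOrder isTotalOrder public using (total; isPartialOrder)
    renaming (refl to ≤-refl; reflexive to ≤-reflexive; trans to ≤-trans; antisym to ≤-antisym)
  open RingProperties ring using (-‿distribˡ-*; -‿involutive)
  open NaturalCoefficients commutativeSemiring using (solve; Polynomial; con; _:+_; _:*_; _:=_) public

  poset : Poset c ℓ₁ ℓ₂
  poset = record { isPartialOrder = isPartialOrder }

  open PartialOrderReasoning poset

  -- Unfolds to fromℕ k, which con k does not.
  numeral : ∀ {n} → ℕ → Polynomial n
  numeral zero    = con 0
  numeral (suc k) = con 1 :+ numeral k

  +-monoʳ-≤ : ∀ x {y z} → y ≤ z → x ⊕ y ≤ x ⊕ z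
  +-monoʳ-≤ x {y} {z} y≤z = begin
    x ⊕ y  ≈⟨ +-comm x y ⟩
    y ⊕ x  ≤⟨ +-monoˡ-≤ x y≤z ⟩
    z ⊕ x  ≈⟨ +-comm z x ⟩
    x ⊕ z  ∎

  +-mono-≤ : ∀ {x y u v} → x ≤ y → u ≤ v → x ⊕ u ≤ y ⊕ v
  +-mono-≤ x≤y u≤v = ≤-trans (+-monoˡ-≤ _ x≤y) (+-monoʳ-≤ _ u≤v)

  ≤-addʳ : ∀ {x y z} → 0# ≤ z → x ≤ y → x ≤ y ⊕ z
  ≤-addʳ {x} {y} {z} 0≤z x≤y = begin
    x       ≈⟨ +-identityʳ x ⟨
    x ⊕ 0#  ≤⟨ +-mono-≤ x≤y 0≤z ⟩
    y ⊕ z   ∎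

  +-cancelʳ-≤ : ∀ {x y} z → x ⊕ z ≤ y ⊕ z → x ≤ y
  +-cancelʳ-≤ {x} {y} z le = begin
    x              ≈⟨ undo x ⟨
    x ⊕ z ⊕ ⊖ z    ≤⟨ +-monoˡ-≤ (⊖ z) le ⟩
    y ⊕ z ⊕ ⊖ z    ≈⟨ undo y ⟩
    y              ∎
    where
    undo : ∀ w → w ⊕ z ⊕ ⊖ z ≈ w
    undo w = trans (+-assoc w z (⊖ z)) (trans (+-congˡ (-‿inverseʳ z)) (+-identityʳ w))

  -- Reduces an inequality to a semiring identity, given a combination p ≤ q of
  -- the hypotheses.
  ≤-certificate : ∀ {p q x y} → p ≤ q → x ⊕ q ≈ y ⊕ p → x ≤ y
  ≤-certificate {p} {q} {x} {y} p≤q eq = +-cancelʳ-≤ q (begin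
    x ⊕ q  ≈⟨ eq ⟩
    y ⊕ p  ≤⟨ +-monoʳ-≤ y p≤q ⟩
    y ⊕ q  ∎)

  *-monoˡ-≤ : ∀ {x y z} → 0# ≤ z → x ≤ y → z ⊛ x ≤ z ⊛ y
  *-monoˡ-≤ {x} {y} {z} 0≤z x≤y = begin
    z ⊛ x                   ≈⟨ +-identityˡ _ ⟨
    0# ⊕ z ⊛ x              ≤⟨ +-monoˡ-≤ _ (*-nonNeg 0≤z 0≤y-x) ⟩
    z ⊛ (y ⊕ ⊖ x) ⊕ z ⊛ x   ≈⟨ distribˡ z _ x ⟨
    z ⊛ (y ⊕ ⊖ x ⊕ x)       ≈⟨ *-congˡ (trans (+-assoc y _ x) (trans (+-congˡ (-‿inverseˡ x)) (+-identityʳ y))) ⟩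
    z ⊛ y                   ∎
    where
    0≤y-x : 0# ≤ y ⊕ ⊖ x
    0≤y-x = ≤-trans (≤-reflexive (sym (-‿inverseʳ x))) (+-monoˡ-≤ (⊖ x) x≤y)

  *-monoʳ-≤ : ∀ {x y z} → 0# ≤ z → x ≤ y → x ⊛ z ≤ y ⊛ z
  *-monoʳ-≤ {x} {y} {z} 0≤z x≤y = begin
    x ⊛ z  ≈⟨ *-comm x z ⟩
    z ⊛ x  ≤⟨ *-monoˡ-≤ 0≤z x≤y ⟩
    z ⊛ y  ≈⟨ *-comm z y ⟩
    y ⊛ z  ∎

  0≤1 : 0# ≤ 1#
  0≤1 with total 0# 1#
  ... | inj₁ le = le
  ... | inj₂ 1≤0 = begin
    0#               ≤⟨ *-nonNeg 0≤-1 0≤-1 ⟩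
    ⊖ 1# ⊛ ⊖ 1#      ≈⟨ -‿distribˡ-* 1# (⊖ 1#) ⟨
    ⊖ (1# ⊛ ⊖ 1#)    ≈⟨ -‿cong (*-identityˡ _) ⟩
    ⊖ ⊖ 1#           ≈⟨ -‿involutive 1# ⟩
    1#               ∎
    where
    0≤-1 : 0# ≤ ⊖ 1#
    0≤-1 = begin
      0#         ≈⟨ -‿inverseʳ 1# ⟨
      1# ⊕ ⊖ 1#  ≤⟨ +-monoˡ-≤ _ 1≤0 ⟩
      0# ⊕ ⊖ 1#  ≈⟨ +-identityˡ _ ⟩
      ⊖ 1#       ∎

  fromℕ-+ : ∀ j k → fromℕ (j ℕ.+ k) ≈ fromℕ j ⊕ fromℕ k
  fromℕ-+ = MonoidMult.×-homo-+ +-monoid 1#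

  fromℕ-* : ∀ j k → fromℕ (j ℕ.* k) ≈ fromℕ j ⊛ fromℕ k
  fromℕ-* = SemiringMult.×1-homo-* semiring

  0≤fromℕ : ∀ k → 0# ≤ fromℕ k
  0≤fromℕ zero    = ≤-refl
  0≤fromℕ (suc k) = ≤-addʳ (0≤fromℕ k) 0≤1

  fromℕ-mono : ∀ {j k} → j ℕ.≤ k → fromℕ j ≤ fromℕ k
  fromℕ-mono {k = k} z≤n = 0≤fromℕ k
  fromℕ-mono (s≤s j≤k)   = +-monoʳ-≤ 1# (fromℕ-mono j≤k)

  fromℕ≉0 : ∀ k → ¬ (fromℕ (suc k) ≈ 0#)
  fromℕ≉0 k eq = 0≉1 (≤-antisym 0≤1 (≤-trans (≤-addʳ (0≤fromℕ k) ≤-refl) (≤-reflexive eq)))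

  ⁻¹-nonNeg : ∀ {x} → 0# ≤ x → ¬ (x ≈ 0#) → 0# ≤ x ⁻¹
  ⁻¹-nonNeg {x} 0≤x x≉0 with total 0# (x ⁻¹)
  ... | inj₁ le = le
  ... | inj₂ x⁻¹≤0 = contradiction (≤-antisym 0≤1 (begin
    1#        ≈⟨ ⁻¹-inverseʳ x x≉0 ⟨
    x ⊛ x ⁻¹  ≤⟨ *-monoˡ-≤ 0≤x x⁻¹≤0 ⟩
    x ⊛ 0#    ≈⟨ zeroʳ x ⟩
    0#        ∎)) 0≉1

  *-cancelˡ-≤ : ∀ {x y z} → 0# ≤ z → ¬ (z ≈ 0#) → z ⊛ x ≤ z ⊛ y → x ≤ y
  *-cancelˡ-≤ {x} {y} {z} 0≤z z≉0 le = begin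
    x                ≈⟨ undo x ⟨
    z ⁻¹ ⊛ (z ⊛ x)   ≤⟨ *-monoˡ-≤ (⁻¹-nonNeg 0≤z z≉0) le ⟩
    z ⁻¹ ⊛ (z ⊛ y)   ≈⟨ undo y ⟩
    y                ∎
    where
    undo : ∀ w → z ⁻¹ ⊛ (z ⊛ w) ≈ w
    undo w = trans (sym (*-assoc _ z w)) (trans (*-congʳ (trans (*-comm _ z) (⁻¹-inverseʳ z z≉0))) (*-identityˡ w))

  -- Descends from an Archimedean bound until the predecessor falls below `x`; totality of the order
  -- decides each comparison.
  ceiling : ∀ x → 0# ≤ x → ∃[ k ] x ≤ fromℕ k × fromℕ k ≤ x ⊕ 1#
  ceiling x 0≤x = search (proj₁ (archimedean x)) (proj₂ (archimedean x))
    where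
    search : ∀ k → x ≤ fromℕ k → ∃[ j ] x ≤ fromℕ j × fromℕ j ≤ x ⊕ 1#
    search zero    x≤0 = zero , x≤0 , ≤-addʳ 0≤1 0≤x
    search (suc k) x≤k with total x (fromℕ k)
    ... | inj₁ le = search k le
    ... | inj₂ k≤x = suc k , x≤k , ≤-trans (+-monoʳ-≤ 1# k≤x) (≤-reflexive (+-comm 1# x))

-- Covers of a changing universe.

module _ {m : ℕ} where

  Covers : Universe m → List (Fin m) → Set
  Covers U S = All (λ x → Any (_∈ S) (proj₂ x)) U

  covers-mono : ∀ {U S S′} → S ⊆ S′ → Covers U S → Covers U S′
  covers-mono S⊆S′ = All.map (Any.map S⊆S′)

  -- Deletion filters out every entry with the given name. Distinctness makes this a single element,
  -- so that one additional set restores a cover of the previous universe.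
  DistinctNames : Universe m → Set
  DistinctNames = AllPairs (_≢_ on proj₁)

  distinctNames-update : ∀ {n U u} → DistinctNames U → Legal n U u → DistinctNames (applyUpdate u U)
  distinctNames-update U! (insert e∉ _ _ _) = All.map⁻ (All.¬Any⇒All¬ _ e∉) ∷ U!
  distinctNames-update U! (delete _)        = AllPairs.filter⁺ _ U!

  name-injective : ∀ {U} → DistinctNames U → ∀ {x y} → x ∈ U → y ∈ U → proj₁ x ≡ proj₁ y → x ≡ y
  name-injective (x! ∷ U!) (here ≡.refl) (here ≡.refl) _  = ≡.refl
  name-injective (x! ∷ U!) (here ≡.refl) (there y∈)    eq = contradiction eq (All.lookup x! y∈)
  name-injective (x! ∷ U!) (there x∈)    (here ≡.refl) eq = contradiction (≡.sym eq) (All.lookup x! x∈)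
  name-injective (x! ∷ U!) (there x∈)    (there y∈)    eq = name-injective U! x∈ y∈ eq

-- The program.

-- L[0], L[1] and L[2] hold the sets that are still to be included, those that
-- are still to be discarded, and those included in the current phase.  M[6 + s]
-- counts the occurrences of s in L[1] and L[2], so that discarding a set takes
-- constant time.

push decrement pop step launch : Program

push = ‵ const 3 6 ⨾ ‵ add 3 3 2 ⨾ ‵ load 4 3 ⨾ ‵ const 5 1 ⨾ ‵ add 4 4 5 ⨾ ‵ store 3 4 ⨾
       ‵ include 2 ⨾ ‵ cons 2 2 2

decrement = ‵ const 3 6 ⨾ ‵ add 3 3 2 ⨾ ‵ load 4 3 ⨾ ‵ const 5 1 ⨾ ‵ sub 4 4 5 ⨾ ‵ store 3 4

pop = decrement ⨾ (ifNonzero 4 then skip else ‵ exclude 2)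

step = ‵ nonempty 1 0 ⨾
       (ifNonzero 1
         then ‵ head 2 0 ⨾ ‵ tail 0 0 ⨾ push
         else (‵ nonempty 1 1 ⨾ (ifNonzero 1 then ‵ head 2 1 ⨾ ‵ tail 1 1 ⨾ pop else skip)))

launch = ‵ nonempty 1 0 ⨾
         (ifNonzero 1 then skip
           else (‵ nonempty 1 1 ⨾
                 (ifNonzero 1 then skip else (‵ copy 1 2 ⨾ ‵ nil 2 ⨾ ‵ query 0))))

cover-new : Program
cover-new = ‵ inserting 1 ⨾ (ifNonzero 1 then ‵ sets 3 ⨾ ‵ head 2 3 ⨾ push else skip)

migrate : ℕ → Program
migrate r = ‵ const 0 r ⨾ (repeat 0 times step)

reduction : ℕ → Program
reduction r = ‵ forward ⨾ (cover-new ⨾ launch) ⨾ migrate r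

-- Leaves out `forward`, whose time belongs to the black box, and loops, whose length depends on the
-- memory. The time of any other program is bounded by its text.
Plain : Program → Set
Plain skip                          = ⊤
Plain (‵ forward)                   = ⊥
Plain (‵ _)                         = ⊤
Plain (P ⨾ Q)                       = Plain P × Plain Q
Plain (ifNonzero _ then P else Q)   = Plain P × Plain Q
Plain (repeat _ times _)            = ⊥

-- Bounds the running time of a program only if it is Plain.
size : Program → ℕ
size skip                        = 0
size (‵ _)                       = 1
size (P ⨾ Q)                     = size P ℕ.+ size Q
size (ifNonzero _ then P else Q) = suc (size P ℕ.+ size Q)
size (repeat _ times _)          = 0

-- The 3 units are `forward` itself apart from the black box's time, the `const` that loads the loop
-- bound, and the exit from the loop. Each iteration costs one unit on top of its body.
setup per-step : ℕ
setup    = 3 ℕ.+ size (cover-new ⨾ launch)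
per-step = suc (size step)

overhead : ℕ → ℕ
overhead r = setup ℕ.+ r ℕ.* per-step

-- Migration in terms of buffers.

record Buffers (m : ℕ) : Set where
  constructor buffers
  field
    pending outdated current : List (Fin m)

open Buffers public

module _ {m : ℕ} where

  advance : Buffers m → Buffers m
  advance (buffers (s ∷ p) o       c) = buffers p o (s ∷ c)
  advance (buffers []      (s ∷ o) c) = buffers [] o c
  advance (buffers []      []      c) = buffers [] [] c

  advances : ℕ → Buffers m → Buffers m
  advances zero    b = b
  advances (suc k) b = advances k (advance b)

  -- Any set containing the new element would do; the first one can be read in constant time.
  -- `Legal` rules out an insertion with the empty list.
  extend : Update m → List (Fin m) → List (Fin m)
  extend (insert _ (s ∷ _)) S = s ∷ S
  extend (insert _ [])      S = S
  extend (delete _)         S = S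

  register : Update m → Buffers m → Buffers m
  register u b = record b { current = extend u (current b) }

  new-phase : List (Fin m) → Buffers m → Buffers m
  new-phase S (buffers (s ∷ p) o       c) = buffers (s ∷ p) o c
  new-phase S (buffers []      (s ∷ o) c) = buffers [] (s ∷ o) c
  new-phase S (buffers []      []      c) = buffers S c []

  occurrences : Fin m → List (Fin m) → ℕ
  occurrences t []      = 0
  occurrences t (s ∷ S) = if does (t Fin.≟ s) then suc (occurrences t S) else occurrences t S

  occurrences-same : ∀ s S → occurrences s (s ∷ S) ≡ suc (occurrences s S)
  occurrences-same s S = ≡.cong (if_then suc (occurrences s S) else occurrences s S) (dec-true (s Fin.≟ s) ≡.refl)

  occurrences-other : ∀ {t s} S → t ≢ s → occurrences t (s ∷ S) ≡ occurrences t S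
  occurrences-other {t} {s} S t≢s = ≡.cong (if_then suc (occurrences t S) else occurrences t S) (dec-false (t Fin.≟ s) t≢s)

  ∈⇒occurrences≢0 : ∀ {t S} → t ∈ S → occurrences t S ≢ 0
  ∈⇒occurrences≢0 {t} {s ∷ S} t∈ eq with t Fin.≟ s | t∈
  ... | no t≢s | here t≡s   = t≢s t≡s
  ... | no _   | there t∈S  = ∈⇒occurrences≢0 t∈S eq

  occurrences≢0⇒∈ : ∀ {t} S → occurrences t S ≢ 0 → t ∈ S
  occurrences≢0⇒∈     []      ≢0 = contradiction ≡.refl ≢0
  occurrences≢0⇒∈ {t} (s ∷ S) ≢0 with t Fin.≟ s
  ... | yes t≡s = here t≡s
  ... | no  _   = there (occurrences≢0⇒∈ S ≢0)

  -- `pending` does not count: the output is the union of `current` and `outdated`, and a pending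
  -- set contributes to it only on moving to `current`.
  multiplicity : Buffers m → Fin m → ℕ
  multiplicity b t = occurrences t (current b) ℕ.+ occurrences t (outdated b)

module _ {m : ℕ} where

  data Idle : Buffers m → Set where
    idle : ∀ {c} → Idle (buffers [] [] c)

  idle? : ∀ b → Dec (Idle b)
  idle? (buffers []      []      c) = yes idle
  idle? (buffers (_ ∷ _) o       c) = no λ ()
  idle? (buffers []      (_ ∷ _) c) = no λ ()

  new-phase-busy : ∀ S {b} → ¬ Idle b → new-phase S b ≡ b
  new-phase-busy S {buffers []      []      c} busy = contradiction idle busy
  new-phase-busy S {buffers (_ ∷ _) o       c} busy = ≡.refl
  new-phase-busy S {buffers []      (_ ∷ _) c} busy = ≡.refl

  remaining : Buffers m → ℕ
  remaining b = length (pending b) ℕ.+ length (outdated b)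

  remaining-advance : ∀ b → remaining (advance b) ≡ remaining b ℕ.∸ 1
  remaining-advance (buffers (s ∷ p) o       c) = ≡.refl
  remaining-advance (buffers []      (s ∷ o) c) = ≡.refl
  remaining-advance (buffers []      []      c) = ≡.refl

  remaining-advances : ∀ k b → remaining (advances k b) ≡ remaining b ℕ.∸ k
  remaining-advances zero    b = ≡.refl
  remaining-advances (suc k) b = ≡.trans (remaining-advances k (advance b))
    (≡.trans (≡.cong (ℕ._∸ k) (remaining-advance b)) (ℕ.∸-+-assoc (remaining b) 1 k))

  remaining≢0 : ∀ {b} → ¬ Idle b → remaining b ≢ 0
  remaining≢0 {buffers []      []      c} busy _ = busy idle

  -- If `k` reached `remaining b`, the truncated difference would be 0 and the buffers idle. So the
  -- subtraction is exact: a phase that is still busy has wasted no step.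
  remaining-busy : ∀ k b → ¬ Idle (advances k b) → remaining (advances k b) ℕ.+ k ≡ remaining b
  remaining-busy k b busy = ≡.trans (≡.cong (ℕ._+ k) eq) (ℕ.m∸n+n≡m {remaining b} {k} (ℕ.<⇒≤ (ℕ.≰⇒> λ rem≤k →
    remaining≢0 busy (≡.trans eq (ℕ.m≤n⇒m∸n≡0 {remaining b} {k} rem≤k)))))
    where
    eq : remaining (advances k b) ≡ remaining b ℕ.∸ k
    eq = remaining-advances k b

  advances-preserve : ∀ {p} (P : Buffers m → Set p) → (∀ b → P b → P (advance b)) →
                      ∀ k b → P b → P (advances k b)
  advances-preserve P pres zero    b Pb = Pb
  advances-preserve P pres (suc k) b Pb = advances-preserve P pres k (advance b) (pres b Pb)

  -- `pending ++ current` is the cover under construction, `current ++ outdated` the output. Sets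
  -- are discarded only after `pending` has run empty, when `current` covers by itself; hence the
  -- disjunction, which a discard re-establishes with `inj₁`.
  record Guarded (U : Universe m) (b : Buffers m) : Set where
    field
      target-covers  : Covers U (pending b ++ current b)
      current-covers : pending b ≡ [] ⊎ Covers U (current b ++ outdated b)

  open Guarded

  guarded-covers : ∀ {U} b → Guarded U b → Covers U (current b ++ outdated b)
  guarded-covers b G with current-covers G
  ... | inj₂ cov       = cov
  ... | inj₁ ≡.refl    = covers-mono ∈-++⁺ˡ (target-covers G)

  extend-⊇ : ∀ (u : Update m) {S} → S ⊆ extend u S
  extend-⊇ (insert _ (s ∷ _)) = there
  extend-⊇ (insert _ [])      = λ t∈ → t∈
  extend-⊇ (delete _)         = λ t∈ → t∈

  covers-update : ∀ {n U S T} {u : Update m} → Legal n U u → extend u S ⊆ T → Covers U T → Covers (applyUpdate u U) T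
  covers-update {u = insert e []}       (insert _ _ ≢[] _) = contradiction ≡.refl ≢[]
  covers-update {u = insert e (s ∷ ss)} _ S⊆ cov = here (S⊆ (here ≡.refl)) ∷ cov
  covers-update {u = delete e}          _ _  cov = All.filter⁺ _ cov

  guarded-register : ∀ {n U u} b → Legal n U u → Guarded U b → Guarded (applyUpdate u U) (register u b)
  guarded-register {u = u} b legal G = record
    { target-covers  = covers-update legal (∈-++⁺ʳ (pending b))
        (covers-mono (++⁺ʳ (pending b) (extend-⊇ u)) (target-covers G))
    ; current-covers = Sum.map₂ (covers-update legal ∈-++⁺ˡ ∘ covers-mono (++⁺ˡ (outdated b) (extend-⊇ u)))
        (current-covers G)
    }

  guarded-new-phase : ∀ {U S} b → Covers U S → Guarded U b → Guarded U (new-phase S b)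
  guarded-new-phase (buffers (_ ∷ _) o       c) cov G = G
  guarded-new-phase (buffers []      (_ ∷ _) c) cov G = G
  guarded-new-phase (buffers []      []      c) cov G = record
    { target-covers  = covers-mono ∈-++⁺ˡ cov
    -- The old target `[] ++ c` is literally the new output `[] ++ c`, with `c` now in the role of
    -- `outdated`.
    ; current-covers = inj₂ (target-covers G)
    }

  guarded-advance : ∀ {U} b → Guarded U b → Guarded U (advance b)
  guarded-advance (buffers [] [] c) G = G
  guarded-advance (buffers [] (s ∷ o) c) G = record
    { target-covers = target-covers G ; current-covers = inj₁ ≡.refl }
  guarded-advance (buffers (s ∷ p) o c) G = record
    { target-covers  = covers-mono shift (target-covers G)
    ; current-covers = inj₂ (covers-mono there (guarded-covers (buffers (s ∷ p) o c) G))
    }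
    where
    shift : s ∷ p ++ c ⊆ p ++ s ∷ c
    shift (here ≡.refl) = ∈-++⁺ʳ p (here ≡.refl)
    shift (there t∈) with ∈-++⁻ p t∈
    ... | inj₁ t∈p = ∈-++⁺ˡ t∈p
    ... | inj₂ t∈c = ∈-++⁺ʳ p (there t∈c)

-- Time and recourse of programs.

module Simulation {a : Level} {m : ℕ} (A : Algorithm a m) where
  open ≡ using (refl; sym; trans; cong; cong₂; subst)
  open import Data.Nat.Base using (_+_; _*_; _∸_; _≤_)
  open Semantics A
  open Configuration
  open DecMembership (Fin._≟_ {m}) using (_∈?_)

  data IncludeView (k : ℕ) (S : List (Fin m)) : List (Fin m) → Set where
    unnamed : (∀ (s : Fin m) → k ≢ toℕ s) → IncludeView k S S
    present : ∀ {s} → k ≡ toℕ s → s ∈ S → IncludeView k S S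
    fresh   : ∀ {s} → k ≡ toℕ s → s ∉ S → IncludeView k S (s ∷ S)

  includeView : ∀ k S → IncludeView k S (includeSet k S)
  includeView k S with k ℕ.<? m
  ... | no  k≮m = unnamed λ { s refl → k≮m (Fin.toℕ<n s) }
  ... | yes k<m with fromℕ< k<m ∈? S
  ...   | yes s∈ = present (sym (Fin.toℕ-fromℕ< k<m)) s∈
  ...   | no  s∉ = fresh (sym (Fin.toℕ-fromℕ< k<m)) s∉

  missing : List (Fin m) → List (Fin m) → ℕ
  missing S S′ = length (filter (λ s → ¬? (s ∈? S′)) S)

  missing-antimono : ∀ R {S S′} → S ⊆ S′ → missing R S′ ≤ missing R S
  missing-antimono R S⊆S′ = Sublist.length-mono-≤ (Sublist.filter⁺ (λ s → ¬? (s ∈? _)) (λ s → ¬? (s ∈? _))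
    (λ { refl s∉S′ → s∉S′ ∘ S⊆S′ }) (Sublist.⊆-refl {x = R}))

  missing-∷ : ∀ s S R → missing (s ∷ S) R ≤ suc (missing S R)
  missing-∷ s S R with s ∈? R
  ... | yes _ = ℕ.n≤1+n _
  ... | no _  = ℕ.≤-refl

  missing-tail : ∀ s S R → missing S R ≤ missing (s ∷ S) R
  missing-tail s S R with s ∈? R
  ... | yes _ = ℕ.≤-refl
  ... | no _  = ℕ.n≤1+n _

  missing-filter : ∀ k S R → missing (excludeSet k S) R ≤ missing S R
  missing-filter k S R = Sublist.length-mono-≤ (Sublist.filter⁺ (λ s → ¬? (s ∈? R)) (λ s → ¬? (s ∈? R))
    (λ { refl s∉R → s∉R }) (Sublist.filter-⊆ (λ s → ¬? (toℕ s ℕ.≟ k)) S))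

  missing-exclude-absent : ∀ {k} R S → All (λ s → toℕ s ≢ k) R → missing R (excludeSet k S) ≤ missing R S
  missing-exclude-absent []      S _ = z≤n
  missing-exclude-absent {k} (s ∷ R) S (s≢k ∷ R≢k) with s ∈? excludeSet k S | s ∈? S
  ... | yes _  | yes _ = missing-exclude-absent R S R≢k
  ... | yes _  | no _  = ℕ.m≤n⇒m≤1+n (missing-exclude-absent R S R≢k)
  ... | no s∉  | yes s∈ = contradiction (∈-filter⁺ (λ s → ¬? (toℕ s ℕ.≟ k)) s∈ s≢k) s∉
  ... | no _   | no _  = s≤s (missing-exclude-absent R S R≢k)

  -- Only entries of `R` named `k` can become missing, and uniqueness of `R` leaves at most one of
  -- them.
  missing-exclude : ∀ k {R} S → Unique R → missing R (excludeSet k S) ≤ suc (missing R S)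
  missing-exclude k {[]}    S _         = z≤n
  missing-exclude k {s ∷ R} S (s∉ ∷ R!) with toℕ s ℕ.≟ k
  ... | yes refl = ℕ.≤-trans (missing-∷ s R (excludeSet k S)) (s≤s (ℕ.≤-trans
    (missing-exclude-absent R S (All.map (λ s≢ eq → s≢ (Fin.toℕ-injective (sym eq))) s∉))
    (missing-tail s R S)))
  ... | no s≢k with s ∈? excludeSet k S | s ∈? S
  ...   | yes _  | yes _ = missing-exclude k S R!
  ...   | yes _  | no _  = ℕ.m≤n⇒m≤1+n (missing-exclude k S R!)
  ...   | no s∉S | yes s∈ = contradiction (∈-filter⁺ (λ s → ¬? (toℕ s ℕ.≟ k)) s∈ s≢k) s∉S
  ...   | no _   | no _  = s≤s (missing-exclude k S R!)

  changes-include : ∀ R k S → changes R (includeSet k S) ≤ suc (changes R S)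
  changes-include R k S with includeSet k S | includeView k S
  ... | _ | unnamed _   = ℕ.n≤1+n _
  ... | _ | present _ _ = ℕ.n≤1+n _
  ... | _ | fresh {s} _ _ = ℕ.≤-trans (ℕ.+-mono-≤ (missing-antimono R {S} {s ∷ S} there) (missing-∷ s S R))
                              (ℕ.≤-reflexive (ℕ.+-suc (missing R S) _))

  changes-exclude : ∀ {R} k S → Unique R → changes R (excludeSet k S) ≤ suc (changes R S)
  changes-exclude {R} k S R! = ℕ.+-mono-≤ (missing-exclude k S R!) (missing-filter k S R)

  changes-self : ∀ S → changes S S ≡ 0
  changes-self S = cong (λ R → length R + length R)
    (List.filter-none (λ s → ¬? (s ∈? S)) {S} (All.tabulate λ s∈ s∉ → s∉ s∈))

  -- One `t` serves for time and recourse, since an instruction takes a unit of time and changes at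
  -- most one set. Changes are measured against an arbitrary fixed `R`, so that bounds add up along
  -- a sequence without a triangle inequality; in the end `R` is the output before the update.
  record Bounded (f : Configuration → Configuration × ℕ) (t : ℕ) : Set a where
    field
      blackBox-unchanged : ∀ γ → blackBox (proj₁ (f γ)) ≡ blackBox γ
      time≤              : ∀ γ → proj₂ (f γ) ≤ t
      changes≤           : ∀ {R} γ → Unique R → changes R (output (proj₁ (f γ))) ≤ t + changes R (output γ)

  open Bounded

  silent : ∀ {f : Configuration → Configuration} →
             (∀ γ → blackBox (f γ) ≡ blackBox γ) → (∀ γ → output (f γ) ≡ output γ) →
             Bounded (λ γ → f γ , 1) 1
  silent b o .blackBox-unchanged = b
  silent b o .time≤ γ = ℕ.≤-refl
  silent b o .changes≤ {R} γ _ = ℕ.≤-trans (ℕ.≤-reflexive (cong (changes R) (o γ))) (ℕ.n≤1+n _)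

  instruction-bounded : ∀ i u → Plain (‵ i) → Bounded (run (‵ i) u) 1
  instruction-bounded (const x k)    u _ = silent (λ _ → refl) (λ _ → refl)
  instruction-bounded (move x y)     u _ = silent (λ _ → refl) (λ _ → refl)
  instruction-bounded (add x y z)    u _ = silent (λ _ → refl) (λ _ → refl)
  instruction-bounded (sub x y z)    u _ = silent (λ _ → refl) (λ _ → refl)
  instruction-bounded (load x y)     u _ = silent (λ _ → refl) (λ _ → refl)
  instruction-bounded (store x y)    u _ = silent (λ _ → refl) (λ _ → refl)
  instruction-bounded (nil p)        u _ = silent (λ _ → refl) (λ _ → refl)
  instruction-bounded (cons p x q)   u _ = silent (λ _ → refl) (λ _ → refl)
  instruction-bounded (copy p q)     u _ = silent (λ _ → refl) (λ _ → refl)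
  instruction-bounded (head x p)     u _ = silent (λ _ → refl) (λ _ → refl)
  instruction-bounded (tail p q)     u _ = silent (λ _ → refl) (λ _ → refl)
  instruction-bounded (nonempty x p) u _ = silent (λ _ → refl) (λ _ → refl)
  instruction-bounded (inserting x)  u _ = silent (λ _ → refl) (λ _ → refl)
  instruction-bounded (element x)    u _ = silent (λ _ → refl) (λ _ → refl)
  instruction-bounded (sets p)       u _ = silent (λ _ → refl) (λ _ → refl)
  instruction-bounded (query p)      u _ = silent (λ _ → refl) (λ _ → refl)
  instruction-bounded (include x)    u _ = record
    { blackBox-unchanged = λ _ → refl
    ; time≤              = λ _ → ℕ.≤-refl
    ; changes≤           = λ {R} γ _ → changes-include R (memory γ x) (output γ)
    }
  instruction-bounded (exclude x)    u _ = record
    { blackBox-unchanged = λ _ → refl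
    ; time≤              = λ _ → ℕ.≤-refl
    ; changes≤           = λ γ R! → changes-exclude (memory γ x) (output γ) R!
    }

  sequence-bounded : ∀ {f g s t} → Bounded f s → Bounded g t →
    Bounded (λ γ → proj₁ (g (proj₁ (f γ))) , proj₂ (f γ) + proj₂ (g (proj₁ (f γ)))) (s + t)
  sequence-bounded bf bg .blackBox-unchanged γ = trans (blackBox-unchanged bg _) (blackBox-unchanged bf γ)
  sequence-bounded bf bg .time≤ γ = ℕ.+-mono-≤ (time≤ bf γ) (time≤ bg _)
  sequence-bounded {f} {g} {s} {t} bf bg .changes≤ {R} γ R! = begin
    changes R (output (proj₁ (g (proj₁ (f γ)))))  ≤⟨ changes≤ bg _ R! ⟩
    t + changes R (output (proj₁ (f γ)))          ≤⟨ ℕ.+-monoʳ-≤ t (changes≤ bf γ R!) ⟩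
    t + (s + changes R (output γ))                ≡⟨ ℕ.+-assoc t s _ ⟨
    t + s + changes R (output γ)                  ≡⟨ cong (_+ changes R (output γ)) (ℕ.+-comm t s) ⟩
    s + t + changes R (output γ)                  ∎
    where open ℕ.≤-Reasoning

  weaken : ∀ {f s t} → s ≤ t → Bounded f s → Bounded f t
  weaken s≤t b .blackBox-unchanged = blackBox-unchanged b
  weaken s≤t b .time≤ γ = ℕ.≤-trans (time≤ b γ) s≤t
  weaken s≤t b .changes≤ γ R! = ℕ.≤-trans (changes≤ b γ R!) (ℕ.+-monoˡ-≤ _ s≤t)

  delay : ∀ {f t} → Bounded f t → Bounded (λ γ → proj₁ (f γ) , suc (proj₂ (f γ))) (suc t)
  delay b .blackBox-unchanged = blackBox-unchanged b
  delay b .time≤ γ = s≤s (time≤ b γ)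
  delay b .changes≤ γ R! = ℕ.m≤n⇒m≤1+n (changes≤ b γ R!)

  wait : ∀ t → Bounded (λ γ → γ , t) t
  wait t .blackBox-unchanged γ = refl
  wait t .time≤ γ = ℕ.≤-refl
  wait t .changes≤ γ _ = ℕ.m≤n+m _ t

  if-bounded : ∀ x {P Q t} u → Bounded (run P u) t → Bounded (run Q u) t →
               Bounded (run (ifNonzero x then P else Q) u) (suc t)
  if-bounded x u bP bQ .blackBox-unchanged γ with memory γ x
  ... | suc _ = blackBox-unchanged bP γ
  ... | zero  = blackBox-unchanged bQ γ
  if-bounded x u bP bQ .time≤ γ with memory γ x
  ... | suc _ = s≤s (time≤ bP γ)
  ... | zero  = s≤s (time≤ bQ γ)
  if-bounded x u bP bQ .changes≤ γ R! with memory γ x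
  ... | suc _ = ℕ.m≤n⇒m≤1+n (changes≤ bP γ R!)
  ... | zero  = ℕ.m≤n⇒m≤1+n (changes≤ bQ γ R!)

  plain-bounded : ∀ P u → Plain P → Bounded (run P u) (size P)
  plain-bounded skip u _ = wait 0
  plain-bounded (‵ i) u p = instruction-bounded i u p
  plain-bounded (P ⨾ Q) u (p , q) = sequence-bounded (plain-bounded P u p) (plain-bounded Q u q)
  plain-bounded (ifNonzero x then P else Q) u (p , q) = if-bounded x u
    (weaken (ℕ.m≤m+n (size P) _) (plain-bounded P u p))
    (weaken (ℕ.m≤n+m (size Q) _) (plain-bounded Q u q))

  loop-bounded : ∀ k {f t} → Bounded f t → Bounded (loop k f) (suc (k * suc t))
  loop-bounded zero    b = wait 1
  loop-bounded (suc k) {f} {t} b = weaken (ℕ.≤-reflexive (cong suc (ℕ.+-suc t (k * suc t))))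
    (delay (sequence-bounded b (loop-bounded k b)))

  migrate-bounded : ∀ r u → Bounded (run (migrate r) u) (2 + r * suc (size step))
  migrate-bounded r u = record
    { blackBox-unchanged = λ γ → blackBox-unchanged repeated (setMemory 0 r γ)
    ; time≤              = λ γ → s≤s (time≤ repeated (setMemory 0 r γ))
    ; changes≤           = λ γ R! → ℕ.m≤n⇒m≤1+n (changes≤ repeated (setMemory 0 r γ) R!)
    }
    where
    repeated : Bounded (loop r (run step u)) (suc (r * suc (size step)))
    repeated = loop-bounded r (plain-bounded step u _)

  internal-part-bounded : ∀ r u →
    Bounded (run ((cover-new ⨾ launch) ⨾ migrate r) u)
      (size (cover-new ⨾ launch) + (2 + r * suc (size step)))
  internal-part-bounded r u = sequence-bounded {f = run (cover-new ⨾ launch) u} {g = run (migrate r) u}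
    (plain-bounded (cover-new ⨾ launch) u _) (migrate-bounded r u)

  -- The memory represents the buffers.

  record Counts (cells : Fin m → ℕ) (S : List (Fin m)) (f : Fin m → ℕ) : Set where
    field
      counter         : ∀ t → cells t ≡ f t
      output-unique   : Unique S
      output-positive : ∀ {t} → t ∈ S → f t ≢ 0
      output-complete : ∀ {t} → f t ≢ 0 → t ∈ S

  open Counts public

  -- Addresses 0 to 5 are scratch cells. That `6 + toℕ t` differs from each of them is decided by
  -- computation, so writes to scratch cells preserve the counters by `refl`.
  Tracks : Configuration → (Fin m → ℕ) → Set
  Tracks γ = Counts (λ t → memory γ (6 + toℕ t)) (output γ)

  record Represents (γ : Configuration) (b : Buffers m) : Set where
    field
      pending-list  : lists γ 0 ≡ map toℕ (pending b)
      outdated-list : lists γ 1 ≡ map toℕ (outdated b)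
      current-list  : lists γ 2 ≡ map toℕ (current b)
      tracks        : Tracks γ (multiplicity b)

  open Represents public

  transfer : ∀ {γ γ′ b} → lists γ′ ≡ lists γ → (∀ t → memory γ′ (6 + toℕ t) ≡ memory γ (6 + toℕ t)) →
             output γ′ ≡ output γ → Represents γ b → Represents γ′ b
  transfer lists≡ cells≡ output≡ R = record
    { pending-list  = trans (cong (λ l → l 0) lists≡) (pending-list R)
    ; outdated-list = trans (cong (λ l → l 1) lists≡) (outdated-list R)
    ; current-list  = trans (cong (λ l → l 2) lists≡) (current-list R)
    ; tracks        = record
      { counter         = λ t → trans (cells≡ t) (counter (tracks R) t)
      ; output-unique   = subst Unique (sym output≡) (output-unique (tracks R))
      ; output-positive = λ t∈ → output-positive (tracks R) (subst (_ ∈_) output≡ t∈)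
      ; output-complete = λ ≢0 → subst (_ ∈_) (sym output≡) (output-complete (tracks R) ≢0)
      }
    }

  -- Abstracts the tested cell once, for an arbitrary predicate `Q`, and hands its value to the
  -- branches as an equation.
  if-elim : ∀ {ℓ} (Q : Configuration → Set ℓ) {x P R} u γ →
            (∀ {k} → memory γ x ≡ suc k → Q (proj₁ (run P u γ))) →
            (memory γ x ≡ 0 → Q (proj₁ (run R u γ))) →
            Q (proj₁ (run (ifNonzero x then P else R) u γ))
  if-elim Q {x} u γ onTrue onFalse with memory γ x
  ... | suc _ = onTrue refl
  ... | zero  = onFalse refl

  include-unique : ∀ k {S} → Unique S → Unique (includeSet k S)
  include-unique k {S} S! with includeSet k S | includeView k S
  ... | _ | unnamed _   = S!
  ... | _ | present _ _ = S!
  ... | _ | fresh _ s∉  = All.¬Any⇒All¬ S s∉ ∷ S!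

  include-⊇ : ∀ k {S} → S ⊆ includeSet k S
  include-⊇ k {S} with includeSet k S | includeView k S
  ... | _ | unnamed _   = λ t∈ → t∈
  ... | _ | present _ _ = λ t∈ → t∈
  ... | _ | fresh _ _   = there

  include-∈ : ∀ {k s} S → k ≡ toℕ s → s ∈ includeSet k S
  include-∈ {k} {s} S eq with includeSet k S | includeView k S
  ... | _ | unnamed ≢    = contradiction eq (≢ s)
  ... | _ | present ≡s t∈ = subst (_∈ S) (Fin.toℕ-injective (trans (sym ≡s) eq)) t∈
  ... | _ | fresh ≡s _    = here (Fin.toℕ-injective (trans (sym eq) ≡s))

  include-⊆ : ∀ {k s S T} → k ≡ toℕ s → S ⊆ T → includeSet k S ⊆ s ∷ T
  include-⊆ {k} {s} {S} eq S⊆T t∈ with includeSet k S | includeView k S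
  ... | _ | unnamed _   = there (S⊆T t∈)
  ... | _ | present _ _ = there (S⊆T t∈)
  ... | _ | fresh ≡s _ with t∈
  ...   | here refl = here (Fin.toℕ-injective (trans (sym ≡s) eq))
  ...   | there t∈S = there (S⊆T t∈S)

  counts-cong : ∀ {cells S f g} → (∀ t → f t ≡ g t) → Counts cells S f → Counts cells S g
  counts-cong f≗g T .counter t = trans (counter T t) (f≗g t)
  counts-cong f≗g T .output-unique = output-unique T
  counts-cong f≗g T .output-positive {t} t∈ = output-positive T t∈ ∘ trans (f≗g t)
  counts-cong f≗g T .output-complete {t} ≢0 = output-complete T (≢0 ∘ trans (sym (f≗g t)))

  -- The conditional is what reading a counter after a `store` reduces to, the common offset 6
  -- having cancelled by computation.
  cell-update : ∀ {k s v} (f g : Fin m → ℕ) → k ≡ toℕ s → v ≡ g s → (∀ t → t ≢ s → f t ≡ g t) →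
                ∀ t → (if does (toℕ t ℕ.≟ k) then v else f t) ≡ g t
  cell-update {s = s} {v} f g refl same other t with t Fin.≟ s
  ... | yes refl = trans (cong (if_then v else f t) (dec-true (toℕ t ℕ.≟ toℕ t) refl)) same
  ... | no t≢s   = trans (cong (if_then v else f t) (dec-false (toℕ t ℕ.≟ toℕ s) (t≢s ∘ Fin.toℕ-injective)))
                     (other t t≢s)

  push-tracks : ∀ {γ f s} u (g : Fin m → ℕ) → memory γ 2 ≡ toℕ s →
                g s ≡ suc (f s) → (∀ t → t ≢ s → g t ≡ f t) →
                Tracks γ f → Tracks (proj₁ (run push u γ)) g
  push-tracks {γ} {f} {s} u g s≡ gs g≗f T = record
    { counter         = cell-update (λ t → memory γ (6 + toℕ t)) g s≡
        (trans (cong (λ k → memory γ (6 + k) + 1) s≡)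
          (trans (cong (_+ 1) (counter T s)) (trans (ℕ.+-comm (f s) 1) (sym gs))))
        (λ t t≢s → trans (counter T t) (sym (g≗f t t≢s)))
    ; output-unique   = include-unique (memory γ 2) (output-unique T)
    ; output-positive = positive
    ; output-complete = complete
    }
    where
    positive : ∀ {t} → t ∈ includeSet (memory γ 2) (output γ) → g t ≢ 0
    positive {t} t∈ gt≡0 with t Fin.≟ s
    ... | yes refl = ℕ.1+n≢0 (trans (sym gs) gt≡0)
    ... | no t≢s with include-⊆ s≡ (λ z → z) t∈
    ...   | here t≡s = t≢s t≡s
    ...   | there t∈′ = output-positive T t∈′ (trans (sym (g≗f t t≢s)) gt≡0)

    complete : ∀ {t} → g t ≢ 0 → t ∈ includeSet (memory γ 2) (output γ)
    complete {t} gt≢0 with t Fin.≟ s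
    ... | yes refl = include-∈ (output γ) s≡
    ... | no t≢s   = include-⊇ (memory γ 2) (output-complete T (gt≢0 ∘ trans (g≗f t t≢s)))

  pop-tracks : ∀ {γ f s} u (g : Fin m → ℕ) → memory γ 2 ≡ toℕ s →
               f s ≡ suc (g s) → (∀ t → t ≢ s → f t ≡ g t) →
               Tracks γ f → Tracks (proj₁ (run pop u γ)) g
  pop-tracks {γ} {f} {s} u g s≡ fs f≗g T =
    -- Cell 4 still holds the decremented counter, so the test asks whether the last occurrence of
    -- `s` is gone.
    if-elim (λ γ′ → Tracks γ′ g) {4} {skip} {‵ exclude 2} u (proj₁ (run decrement u γ))
      (λ gs≢0 → record
        { counter         = counted
        ; output-unique   = output-unique T
        ; output-positive = λ {t} → retained (λ gs≡0 → ℕ.1+n≢0 (trans (sym gs≢0) (trans value gs≡0))) {t}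
        ; output-complete = λ gt≢0 → output-complete T (grow gt≢0)
        })
      (λ gs≡0 → record
        { counter         = counted
        ; output-unique   = AllPairs.filter⁺ _ (output-unique T)
        ; output-positive = λ {t} t∈ → let t∈out , t≢s = ∈-filter⁻ kept? {xs = output γ} t∈ in
            subst (_≢ 0) (f≗g t λ t≡s → t≢s (trans (cong toℕ t≡s) (sym s≡))) (output-positive T t∈out)
        ; output-complete = λ {t} gt≢0 → ∈-filter⁺ kept? (output-complete T (grow gt≢0)) λ t≡s →
            gt≢0 (trans (cong g (Fin.toℕ-injective (trans t≡s s≡))) (trans (sym value) gs≡0))
        })
    where
    kept? = λ (t : Fin m) → ¬? (toℕ t ℕ.≟ memory γ 2)

    value : memory γ (6 + memory γ 2) ∸ 1 ≡ g s
    value = trans (cong (λ k → memory γ (6 + k) ∸ 1) s≡) (cong (_∸ 1) (trans (counter T s) fs))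

    counted : ∀ t → (if does (toℕ t ℕ.≟ memory γ 2) then memory γ (6 + memory γ 2) ∸ 1 else memory γ (6 + toℕ t)) ≡ g t
    counted = cell-update (λ t → memory γ (6 + toℕ t)) g s≡ value (λ t t≢s → trans (counter T t) (f≗g t t≢s))

    grow : ∀ {t} → g t ≢ 0 → f t ≢ 0
    grow {t} gt≢0 with t Fin.≟ s
    ... | yes refl = λ ft≡0 → ℕ.1+n≢0 (trans (sym fs) ft≡0)
    ... | no t≢s   = gt≢0 ∘ trans (sym (f≗g t t≢s))

    retained : g s ≢ 0 → ∀ {t} → t ∈ output γ → g t ≢ 0
    retained gs≢0 {t} t∈ with t Fin.≟ s
    ... | yes refl = gs≢0
    ... | no t≢s   = output-positive T t∈ ∘ trans (f≗g t t≢s)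

  pop-lists : ∀ γ u q → lists (proj₁ (run pop u γ)) q ≡ lists γ q
  pop-lists γ u q = if-elim (λ γ′ → lists γ′ q ≡ lists γ q) {4} {skip} {‵ exclude 2} u
    (proj₁ (run decrement u γ)) (λ _ → refl) (λ _ → refl)

  isNonempty-[] : ∀ {l k} → l ≡ [] → isNonempty l ≢ suc k
  isNonempty-[] refl ()

  isNonempty-∷ : ∀ {l k l′} → l ≡ k ∷ l′ → isNonempty l ≢ 0
  isNonempty-∷ refl ()

  step-represents : ∀ {γ} b u → Represents γ b → Represents (proj₁ (run step u γ)) (advance b)
  step-represents {γ} b u R = if-elim (λ γ′ → Represents γ′ (advance b)) {1}
    {‵ head 2 0 ⨾ ‵ tail 0 0 ⨾ push} {pop-outdated} u (proj₁ (run (‵ nonempty 1 0) u γ))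
    (pushed b R)
    (λ empty → if-elim (λ γ′ → Represents γ′ (advance b)) {1}
      {‵ head 2 1 ⨾ ‵ tail 1 1 ⨾ pop} {skip} u (proj₁ (run (‵ nonempty 1 0 ⨾ ‵ nonempty 1 1) u γ))
      (popped b R empty) (λ empty′ → unchanged b R empty empty′))
    where
    pop-outdated : Program
    pop-outdated = ‵ nonempty 1 1 ⨾ (ifNonzero 1 then ‵ head 2 1 ⨾ ‵ tail 1 1 ⨾ pop else skip)

    pushed : ∀ b {k} → Represents γ b → isNonempty (lists γ 0) ≡ suc k →
             Represents (proj₁ (run (‵ nonempty 1 0 ⨾ ‵ head 2 0 ⨾ ‵ tail 0 0 ⨾ push) u γ)) (advance b)
    pushed (buffers [] o c) R full = contradiction full (isNonempty-[] (pending-list R))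
    pushed (buffers (s ∷ p) o c) R _ = record
      { pending-list  = cong tailOr[] (pending-list R)
      ; outdated-list = outdated-list R
      ; current-list  = cong₂ _∷_ s≡ (current-list R)
      ; tracks        = push-tracks {proj₁ (run (‵ nonempty 1 0 ⨾ ‵ head 2 0 ⨾ ‵ tail 0 0) u γ)} u _ s≡
          (cong (_+ _) (occurrences-same s c)) (λ t t≢s → cong (_+ _) (occurrences-other c t≢s))
          (tracks R)
      }
      where
      s≡ : headOr0 (lists γ 0) ≡ toℕ s
      s≡ = cong headOr0 (pending-list R)

    popped : ∀ b {k} → Represents γ b → isNonempty (lists γ 0) ≡ 0 → isNonempty (lists γ 1) ≡ suc k →
             Represents (proj₁ (run (‵ nonempty 1 0 ⨾ ‵ nonempty 1 1 ⨾ ‵ head 2 1 ⨾ ‵ tail 1 1 ⨾ pop) u γ)) (advance b)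
    popped (buffers (s ∷ p) o c) R empty _ = contradiction empty (isNonempty-∷ (pending-list R))
    popped (buffers [] [] c) R _ full = contradiction full (isNonempty-[] (outdated-list R))
    popped (buffers [] (s ∷ o) c) R _ _ = record
      { pending-list  = trans (pop-lists γ′ u 0) (pending-list R)
      ; outdated-list = trans (pop-lists γ′ u 1) (cong tailOr[] (outdated-list R))
      ; current-list  = trans (pop-lists γ′ u 2) (current-list R)
      ; tracks        = pop-tracks {γ′} u _ (cong headOr0 (outdated-list R))
          (trans (cong (occurrences s c +_) (occurrences-same s o)) (ℕ.+-suc _ _))
          (λ t t≢s → cong (occurrences t c +_) (occurrences-other o t≢s)) (tracks R)
      }
      where
      γ′ : Configuration
      γ′ = proj₁ (run (‵ nonempty 1 0 ⨾ ‵ nonempty 1 1 ⨾ ‵ head 2 1 ⨾ ‵ tail 1 1) u γ)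

    unchanged : ∀ b → Represents γ b → isNonempty (lists γ 0) ≡ 0 → isNonempty (lists γ 1) ≡ 0 →
                Represents (proj₁ (run (‵ nonempty 1 0 ⨾ ‵ nonempty 1 1) u γ)) (advance b)
    unchanged (buffers (s ∷ p) o c) R empty _ = contradiction empty (isNonempty-∷ (pending-list R))
    unchanged (buffers [] (s ∷ o) c) R _ empty = contradiction empty (isNonempty-∷ (outdated-list R))
    unchanged (buffers [] [] c) R _ _ = transfer refl (λ _ → refl) refl R

  launch-represents : ∀ {γ} b u → Represents γ b →
    Represents (proj₁ (run launch u γ)) (new-phase (Algorithm.solution A (blackBox γ)) b)
  launch-represents {γ} b u R = if-elim (λ γ′ → Represents γ′ (new-phase S b)) {1}
    {skip} {start-if-idle} u (proj₁ (run (‵ nonempty 1 0) u γ))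
    (busy b R)
    (λ empty → if-elim (λ γ′ → Represents γ′ (new-phase S b)) {1}
      {skip} {‵ copy 1 2 ⨾ ‵ nil 2 ⨾ ‵ query 0} u (proj₁ (run (‵ nonempty 1 0 ⨾ ‵ nonempty 1 1) u γ))
      (busy′ b R empty) (λ empty′ → started b R empty empty′))
    where
    S : List (Fin m)
    S = Algorithm.solution A (blackBox γ)

    start-if-idle : Program
    start-if-idle = ‵ nonempty 1 1 ⨾ (ifNonzero 1 then skip else (‵ copy 1 2 ⨾ ‵ nil 2 ⨾ ‵ query 0))

    busy : ∀ b {k} → Represents γ b → isNonempty (lists γ 0) ≡ suc k →
           Represents (proj₁ (run (‵ nonempty 1 0) u γ)) (new-phase S b)
    busy (buffers [] o c) R full = contradiction full (isNonempty-[] (pending-list R))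
    busy (buffers (s ∷ p) o c) R _ = transfer refl (λ _ → refl) refl R

    busy′ : ∀ b {k} → Represents γ b → isNonempty (lists γ 0) ≡ 0 → isNonempty (lists γ 1) ≡ suc k →
            Represents (proj₁ (run (‵ nonempty 1 0 ⨾ ‵ nonempty 1 1) u γ)) (new-phase S b)
    busy′ (buffers (s ∷ p) o c) R empty _ = contradiction empty (isNonempty-∷ (pending-list R))
    busy′ (buffers [] [] c) R _ full = contradiction full (isNonempty-[] (outdated-list R))
    busy′ (buffers [] (s ∷ o) c) R _ _ = transfer refl (λ _ → refl) refl R

    started : ∀ b → Represents γ b → isNonempty (lists γ 0) ≡ 0 → isNonempty (lists γ 1) ≡ 0 →
      Represents (proj₁ (run (‵ nonempty 1 0 ⨾ ‵ nonempty 1 1 ⨾ ‵ copy 1 2 ⨾ ‵ nil 2 ⨾ ‵ query 0) u γ)) (new-phase S b)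
    started (buffers (s ∷ p) o c) R empty _ = contradiction empty (isNonempty-∷ (pending-list R))
    started (buffers [] (s ∷ o) c) R _ empty = contradiction empty (isNonempty-∷ (outdated-list R))
    started (buffers [] [] c) R _ _ = record
      { pending-list  = refl
      ; outdated-list = current-list R
      ; current-list  = refl
      -- Starting a phase only relabels lists: each multiplicity turns from `k + 0` into `0 + k`,
      -- and neither the counters nor the output change.
      ; tracks        = counts-cong (λ t → ℕ.+-identityʳ _) (tracks R)
      }

  cover-new-represents : ∀ {n U γ b} u → Legal n U u → Represents γ b →
                         Represents (proj₁ (run cover-new u γ)) (register u b)
  cover-new-represents (insert e []) (insert _ _ ≢[] _) R = contradiction refl ≢[]
  cover-new-represents {γ = γ} {b} (insert e (s ∷ ss)) _ R = record
    { pending-list  = pending-list R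
    ; outdated-list = outdated-list R
    ; current-list  = cong (toℕ s ∷_) (current-list R)
    ; tracks        = push-tracks {proj₁ (run (‵ inserting 1 ⨾ ‵ sets 3 ⨾ ‵ head 2 3) (insert e (s ∷ ss)) γ)}
        (insert e (s ∷ ss)) _ refl
        (cong (_+ occurrences s (outdated b)) (occurrences-same s (current b)))
        (λ t t≢s → cong (_+ occurrences t (outdated b)) (occurrences-other (current b) t≢s)) (tracks R)
    }
  cover-new-represents (delete e) _ R = transfer refl (λ _ → refl) refl R

  loop-represents : ∀ k {γ} b u → Represents γ b →
                    Represents (proj₁ (loop k (run step u) γ)) (advances k b)
  loop-represents zero    b u R = R
  loop-represents (suc k) b u R = loop-represents k (advance b) u (step-represents b u R)

  processed : ℕ → Update m → Algorithm.State A → Buffers m → Buffers m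
  processed r u σ b = advances r (new-phase (Algorithm.solution A (Algorithm.update A σ u)) (register u b))

  reduction-represents : ∀ r {n U γ b} u → Legal n U u → Represents γ b →
    Represents (proj₁ (run (reduction r) u γ)) (processed r u (blackBox γ) b)
  reduction-represents r {γ = γ} {b} u legal R = loop-represents r _ u (transfer refl (λ _ → refl) refl launched)
    where
    γ₁ : Configuration
    γ₁ = proj₁ (run (‵ forward) u γ)

    covered : Represents (proj₁ (run cover-new u γ₁)) (register u b)
    covered = cover-new-represents u legal (transfer refl (λ _ → refl) refl R)

    launched : Represents (proj₁ (run (cover-new ⨾ launch) u γ₁))
                 (new-phase (Algorithm.solution A (Algorithm.update A (blackBox γ) u)) (register u b))
    -- The snapshot is queried after `forward` and `cover-new`. As `cover-new` branches on the
    -- unknown update, computation alone does not show that it leaves the black box as it was.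
    launched = subst
      (λ σ → Represents (proj₁ (run (cover-new ⨾ launch) u γ₁)) (new-phase (Algorithm.solution A σ) (register u b)))
      (Bounded.blackBox-unchanged (plain-bounded cover-new u _) γ₁)
      (launch-represents (register u b) u covered)

  represented-⊆ : ∀ {γ b} → Represents γ b → ∀ {t} → t ∈ output γ → t ∈ current b ++ outdated b
  represented-⊆ {b = b} R {t} t∈ with occurrences t (current b) in e
  ... | suc _ = ∈-++⁺ˡ (occurrences≢0⇒∈ (current b) (λ ≡0 → ℕ.1+n≢0 (trans (sym e) ≡0)))
  ... | zero  = ∈-++⁺ʳ (current b) (occurrences≢0⇒∈ (outdated b) λ ≡0 →
    output-positive (tracks R) t∈ (cong₂ _+_ e ≡0))

  represented-⊇ : ∀ {γ b} → Represents γ b → ∀ {t} → t ∈ current b ++ outdated b → t ∈ output γ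
  represented-⊇ {b = b} R {t} t∈ = output-complete (tracks R) λ ≡0 →
    Sum.[ (λ t∈c → ∈⇒occurrences≢0 t∈c (ℕ.m+n≡0⇒m≡0 _ ≡0))
        , (λ t∈o → ∈⇒occurrences≢0 t∈o (ℕ.m+n≡0⇒n≡0 (occurrences t (current b)) ≡0)) ] (∈-++⁻ (current b) t∈)

  reduction-blackBox : ∀ r γ u → blackBox (proj₁ (run (reduction r) u γ)) ≡ Algorithm.update A (blackBox γ) u
  reduction-blackBox r γ u = blackBox-unchanged (internal-part-bounded r u) _

  overhead-split : ∀ r → suc (size (cover-new ⨾ launch) + (2 + r * per-step)) ≡ overhead r
  overhead-split r = refl

  reduction-time : ∀ r γ u → proj₂ (run (reduction r) u γ) ≤ Algorithm.time A (blackBox γ) u + overhead r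
  reduction-time r γ u = ℕ.≤-trans
    (s≤s (ℕ.+-monoʳ-≤ (Algorithm.time A (blackBox γ) u) (time≤ (internal-part-bounded r u) (proj₁ (run (‵ forward) u γ)))))
    (ℕ.≤-reflexive (trans (sym (ℕ.+-suc _ _)) (cong (Algorithm.time A (blackBox γ) u +_) (overhead-split r))))

  reduction-changes : ∀ r γ u → Unique (output γ) →
                      changes (output γ) (output (proj₁ (run (reduction r) u γ))) ≤ overhead r
  reduction-changes r γ u out! = begin
    changes (output γ) (output (proj₁ (run (reduction r) u γ)))  ≤⟨ changes≤ (internal-part-bounded r u) _ out! ⟩
    internal-overhead + changes (output γ) (output γ)            ≡⟨ cong (internal-overhead +_) (changes-self (output γ)) ⟩
    internal-overhead + 0                                        ≡⟨ ℕ.+-identityʳ _ ⟩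
    internal-overhead                                            ≤⟨ ℕ.n≤1+n _ ⟩
    suc internal-overhead                                        ≡⟨ overhead-split r ⟩
    overhead r                                                   ∎
    where
    open ℕ.≤-Reasoning
    internal-overhead = size (cover-new ⨾ launch) + (2 + r * suc (size step))

-- Costs, drift and the length of a phase.

module Field {c ℓ₁ ℓ₂ : Level} (F : ArchimedeanOrderedField c ℓ₁ ℓ₂) where
  open ArchimedeanOrderedField F hiding (zero)
  open OrderedField F
  open PartialOrderReasoning poset hiding (start)

  -- ζ ⊛ opt bounds the number of updates in a phase.
  module Estimates {α C ζ r : Carrier} (1≤α : 1# ≤ α) (1≤C : 1# ≤ C) (0≤ζ : 0# ≤ ζ)
    (2ζ≤1 : fromℕ 2 ⊛ ζ ≤ 1#) (6αC≤rζ : fromℕ 6 ⊛ (α ⊛ C) ≤ r ⊛ ζ) (0≤r : 0# ≤ r) where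

    0≤α : 0# ≤ α
    0≤α = ≤-trans 0≤1 1≤α

    0≤C : 0# ≤ C
    0≤C = ≤-trans 0≤1 1≤C

    private
      1≤αC : 1# ≤ α ⊛ C
      1≤αC = begin
        1#      ≈⟨ *-identityʳ 1# ⟨
        1# ⊛ 1# ≤⟨ *-monoˡ-≤ 0≤1 1≤C ⟩
        1# ⊛ C  ≤⟨ *-monoʳ-≤ 0≤C 1≤α ⟩
        α ⊛ C   ∎

      12αC≤r : fromℕ 12 ⊛ (α ⊛ C) ≤ r
      12αC≤r = begin
        fromℕ 12 ⊛ (α ⊛ C)           ≈⟨ solve 1 (λ b → numeral 12 :* b := numeral 2 :* (numeral 6 :* b)) refl (α ⊛ C) ⟩
        fromℕ 2 ⊛ (fromℕ 6 ⊛ (α ⊛ C)) ≤⟨ *-monoˡ-≤ (0≤fromℕ 2) 6αC≤rζ ⟩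
        fromℕ 2 ⊛ (r ⊛ ζ)            ≈⟨ solve 2 (λ r ζ → numeral 2 :* (r :* ζ) := r :* (numeral 2 :* ζ)) refl r ζ ⟩
        r ⊛ (fromℕ 2 ⊛ ζ)            ≤⟨ *-monoˡ-≤ 0≤r 2ζ≤1 ⟩
        r ⊛ 1#                       ≈⟨ *-identityʳ r ⟩
        r                            ∎

      r≉0 : ¬ (r ≈ 0#)
      r≉0 r≈0 = 0≉1 (≤-antisym 0≤1 (begin
        1#                  ≤⟨ 1≤αC ⟩
        α ⊛ C               ≤⟨ ≤-addʳ (*-nonNeg (0≤fromℕ 11) (*-nonNeg 0≤α 0≤C)) ≤-refl ⟩
        α ⊛ C ⊕ fromℕ 11 ⊛ (α ⊛ C) ≈⟨ solve 1 (λ b → b :+ numeral 11 :* b := numeral 12 :* b) refl (α ⊛ C) ⟩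
        fromℕ 12 ⊛ (α ⊛ C)  ≤⟨ 12αC≤r ⟩
        r                   ≈⟨ r≈0 ⟩
        0#                  ∎))

    -- Doubling `work` gives `2rq ≤ 6αC opt + 12αC q`. The first summand is at most `rζ opt` and the
    -- second at most `rq`; cancelling `rq`, then `r`, leaves the claim.
    drift-bound : ∀ {opt q} → 0# ≤ opt → 0# ≤ q →
                  r ⊛ q ≤ fromℕ 3 ⊛ (α ⊛ C) ⊛ (opt ⊕ fromℕ 2 ⊛ q) → q ≤ ζ ⊛ opt
    drift-bound {opt} {q} 0≤opt 0≤q work = *-cancelˡ-≤ 0≤r r≉0
      (≤-certificate
        (+-mono-≤ (*-monoˡ-≤ (0≤fromℕ 2) work)
          (+-mono-≤ (*-monoʳ-≤ 0≤opt 6αC≤rζ) (*-monoʳ-≤ 0≤q 12αC≤r)))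
        (solve 5 (λ r ζ b opt q →
           r :* q :+ (numeral 2 :* (numeral 3 :* b :* (opt :+ numeral 2 :* q)) :+ (r :* ζ :* opt :+ r :* q))
           := r :* (ζ :* opt) :+ (numeral 2 :* (r :* q) :+ (numeral 6 :* b :* opt :+ numeral 12 :* b :* q)))
          refl r ζ (α ⊛ C) opt q))

    -- Passing from `o` to `opt` costs `αℓ`, the sets received for insertions another `ℓ ≤ αℓ`, and
    -- `2αℓ ≤ 2αζ opt`.
    settled-cost : ∀ {x o opt ℓ} → 0# ≤ ℓ → x ≤ α ⊛ o ⊕ ℓ → o ≤ opt ⊕ ℓ → ℓ ≤ ζ ⊛ opt →
                   x ≤ α ⊛ (opt ⊕ fromℕ 2 ⊛ ζ ⊛ opt)
    settled-cost {x} {o} {opt} {ℓ} 0≤ℓ x≤ o≤ ℓ≤ = ≤-certificate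
      (+-mono-≤ x≤ (+-mono-≤ (*-monoˡ-≤ 0≤α o≤)
        (+-mono-≤ (*-monoʳ-≤ 0≤ℓ 1≤α) (*-monoˡ-≤ (*-nonNeg (0≤fromℕ 2) 0≤α) ℓ≤))))
      (solve 6 (λ α ζ x o opt ℓ →
          x :+ ((α :* o :+ ℓ) :+ (α :* (opt :+ ℓ) :+ (α :* ℓ :+ numeral 2 :* α :* (ζ :* opt))))
          := α :* (opt :+ numeral 2 :* ζ :* opt) :+ (x :+ (α :* o :+ (con 1 :* ℓ :+ numeral 2 :* α :* ℓ))))
        refl α ζ x o opt ℓ)

    -- `x` is the old cover including the set just received, `y` the new snapshot. Replacing `opt`
    -- by `o + 1` adds `α(1 + 2ζ) ≤ 2α`, and the received set adds `1 ≤ α`; this is the constant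
    -- `3α`.
    initial-cost : ∀ {x y o opt} → x ≤ α ⊛ (opt ⊕ fromℕ 2 ⊛ ζ ⊛ opt) ⊕ 1# → opt ≤ o ⊕ 1# →
                   y ≤ α ⊛ o → x ⊕ y ≤ α ⊛ (fromℕ 2 ⊛ o ⊕ fromℕ 2 ⊛ ζ ⊛ o ⊕ fromℕ 3)
    initial-cost {x} {y} {o} {opt} x≤ opt≤ y≤ = ≤-certificate
      (+-mono-≤ x≤ (+-mono-≤ y≤ (+-mono-≤ 1≤α
        (+-mono-≤ (*-monoˡ-≤ 0≤α 2ζ≤1)
          (*-monoʳ-≤ (*-nonNeg 0≤α 0≤1+2ζ) opt≤)))))
      (solve 6 (λ α ζ x y o opt →
          (x :+ y) :+ ((α :* (opt :+ numeral 2 :* ζ :* opt) :+ con 1) :+ (α :* o :+ (α :+ (α :* con 1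
             :+ (o :+ con 1) :* (α :* (con 1 :+ numeral 2 :* ζ))))))
          := α :* (numeral 2 :* o :+ numeral 2 :* ζ :* o :+ numeral 3)
             :+ (x :+ (y :+ (con 1 :+ (α :* (numeral 2 :* ζ) :+ opt :* (α :* (con 1 :+ numeral 2 :* ζ)))))))
        refl α ζ x y o opt)
      where
      0≤1+2ζ : 0# ≤ 1# ⊕ fromℕ 2 ⊛ ζ
      0≤1+2ζ = ≤-addʳ (*-nonNeg (0≤fromℕ 2) 0≤ζ) 0≤1

    initial-work : ∀ {x o} → 0# ≤ o → x ≤ α ⊛ (fromℕ 2 ⊛ o ⊕ fromℕ 2 ⊛ ζ ⊛ o ⊕ fromℕ 3) →
                   C ⊛ x ≤ fromℕ 3 ⊛ (α ⊛ C) ⊛ (o ⊕ 1#)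
    initial-work {x} {o} 0≤o x≤ = ≤-certificate
      (+-mono-≤ (*-monoˡ-≤ 0≤C x≤) (*-monoˡ-≤ (*-nonNeg (*-nonNeg 0≤C 0≤α) 0≤o) 2ζ≤1))
      (solve 5 (λ α C ζ x o →
          C :* x :+ (C :* (α :* (numeral 2 :* o :+ numeral 2 :* ζ :* o :+ numeral 3)) :+ C :* α :* o :* con 1)
          := numeral 3 :* (α :* C) :* (o :+ con 1) :+ (C :* x :+ C :* α :* o :* (numeral 2 :* ζ)))
        refl α C ζ x o)

    -- The drift contributes `(2 + 2ζ)αℓ ≤ 3αℓ`, the received sets `ℓ ≤ αℓ`, and the initial
    -- constant is `3α`: altogether at most `4α(1 + ℓ) ≤ 4αζ opt`. Absorbing the constant is what
    -- requires `1 + ℓ`, and not merely `ℓ`, to be at most `ζ opt`.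
    transition-cost : ∀ {x o opt ℓ} → 0# ≤ ℓ →
      x ≤ α ⊛ (fromℕ 2 ⊛ o ⊕ fromℕ 2 ⊛ ζ ⊛ o ⊕ fromℕ 3) ⊕ ℓ → o ≤ opt ⊕ ℓ → 1# ⊕ ℓ ≤ ζ ⊛ opt →
      x ≤ (fromℕ 2 ⊕ fromℕ 6 ⊛ ζ) ⊛ α ⊛ opt
    transition-cost {x} {o} {opt} {ℓ} 0≤ℓ x≤ o≤ ℓ≤ = ≤-certificate
      (+-mono-≤ x≤ (+-mono-≤ (*-monoˡ-≤ (*-nonNeg 0≤α 0≤2+2ζ) o≤)
        (+-mono-≤ (*-monoʳ-≤ 0≤ℓ 1≤α) (+-mono-≤ (*-monoˡ-≤ (*-nonNeg 0≤α 0≤ℓ) 2ζ≤1)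
          (+-mono-≤ (*-monoˡ-≤ (*-nonNeg (0≤fromℕ 4) 0≤α) ℓ≤) 0≤α)))))
      (solve 6 (λ α ζ x o opt ℓ →
          x :+ ((α :* (numeral 2 :* o :+ numeral 2 :* ζ :* o :+ numeral 3) :+ ℓ)
            :+ (α :* (numeral 2 :+ numeral 2 :* ζ) :* (opt :+ ℓ)
            :+ (α :* ℓ :+ (α :* ℓ :* con 1 :+ (numeral 4 :* α :* (ζ :* opt) :+ α)))))
          := (numeral 2 :+ numeral 6 :* ζ) :* α :* opt
            :+ (x :+ (α :* (numeral 2 :+ numeral 2 :* ζ) :* o
            :+ (con 1 :* ℓ :+ (α :* ℓ :* (numeral 2 :* ζ) :+ (numeral 4 :* α :* (con 1 :+ ℓ) :+ con 0))))))
        refl α ζ x o opt ℓ)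
      where
      0≤2+2ζ : 0# ≤ fromℕ 2 ⊕ fromℕ 2 ⊛ ζ
      0≤2+2ζ = ≤-addʳ (*-nonNeg (0≤fromℕ 2) 0≤ζ) (0≤fromℕ 2)

    settled-ratio : ∀ {opt} → 0# ≤ opt → α ⊛ (opt ⊕ fromℕ 2 ⊛ ζ ⊛ opt) ≤ (fromℕ 2 ⊕ fromℕ 6 ⊛ ζ) ⊛ α ⊛ opt
    settled-ratio {opt} 0≤opt = ≤-certificate
      (*-nonNeg (*-nonNeg (≤-addʳ (*-nonNeg (0≤fromℕ 4) 0≤ζ) 0≤1) 0≤α) 0≤opt)
      (solve 3 (λ α ζ opt →
          α :* (opt :+ numeral 2 :* ζ :* opt) :+ (con 1 :+ numeral 4 :* ζ) :* α :* opt
          := (numeral 2 :+ numeral 6 :* ζ) :* α :* opt :+ con 0)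
        refl α ζ opt)

  -- Costs of covers and the optimum.

  module CoverCosts {C : Carrier} (1≤C : 1# ≤ C) {m : ℕ} (w : Costs F C m) where
    open DecMembership (Fin._≟_ {m}) using (_∈?_)
    open Costs w

    private
      0≤C : 0# ≤ C
      0≤C = ≤-trans 0≤1 1≤C

      C≉0 : ¬ (C ≈ 0#)
      C≉0 C≈0 = 0≉1 (≤-antisym 0≤1 (≤-trans 1≤C (≤-reflexive C≈0)))

    0≤cost : ∀ s → 0# ≤ cost s
    0≤cost s = ≤-trans (⁻¹-nonNeg 0≤C C≉0) (cost-lower s)

    0≤totalCost : ∀ S → 0# ≤ totalCost S
    0≤totalCost []      = ≤-refl
    0≤totalCost (s ∷ S) = ≤-addʳ (0≤totalCost S) (0≤cost s)

    totalCost-++ : ∀ S S′ → totalCost (S ++ S′) ≈ totalCost S ⊕ totalCost S′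
    totalCost-++ []      S′ = sym (+-identityˡ _)
    totalCost-++ (s ∷ S) S′ = trans (+-congˡ (totalCost-++ S S′)) (sym (+-assoc _ _ _))

    length≤C*totalCost : ∀ S → fromℕ (length S) ≤ C ⊛ totalCost S
    length≤C*totalCost []      = ≤-reflexive (sym (zeroʳ C))
    length≤C*totalCost (s ∷ S) = begin
      1# ⊕ fromℕ (length S)        ≈⟨ +-congʳ (⁻¹-inverseʳ C C≉0) ⟨
      C ⊛ C ⁻¹ ⊕ fromℕ (length S)  ≤⟨ +-mono-≤ (*-monoˡ-≤ 0≤C (cost-lower s)) (length≤C*totalCost S) ⟩
      C ⊛ cost s ⊕ C ⊛ totalCost S ≈⟨ distribˡ C _ _ ⟨
      C ⊛ (cost s ⊕ totalCost S)   ∎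

    -- Each entry of `S` is matched with an occurrence in `S′` that is removed before the recursion;
    -- uniqueness of `S` ensures that it is not asked for again. `S′` may have repetitions, as the
    -- concatenated buffers do.
    totalCost-⊆ : ∀ {S S′} → Unique S → S ⊆ S′ → totalCost S ≤ totalCost S′
    totalCost-⊆ {[]}    {S′} _         _  = 0≤totalCost S′
    totalCost-⊆ {s ∷ S} {S′} (s∉ ∷ S!) S⊆ with ∈-∃++ (S⊆ (here ≡.refl))
    ... | A , B , ≡.refl = begin
      cost s ⊕ totalCost S                  ≤⟨ +-monoʳ-≤ _ (totalCost-⊆ S! S⊆A++B) ⟩
      cost s ⊕ totalCost (A ++ B)           ≈⟨ +-congˡ (totalCost-++ A B) ⟩
      cost s ⊕ (totalCost A ⊕ totalCost B)  ≈⟨ solve 3 (λ x a b → x :+ (a :+ b) := a :+ (x :+ b)) refl _ _ _ ⟩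
      totalCost A ⊕ (cost s ⊕ totalCost B)  ≈⟨ totalCost-++ A (s ∷ B) ⟨
      totalCost (A ++ s ∷ B)                ∎
      where
      S⊆A++B : S ⊆ A ++ B
      S⊆A++B t∈ with ∈-++⁻ A (S⊆ (there t∈))
      ... | inj₁ t∈A            = ∈-++⁺ˡ t∈A
      ... | inj₂ (here ≡.refl)  = contradiction ≡.refl (All.lookup s∉ t∈)
      ... | inj₂ (there t∈B)    = ∈-++⁺ʳ A t∈B

    0≤minimum : ∀ {U opt} → IsMinimumCost U opt → 0# ≤ opt
    0≤minimum ((S , _ , eq) , _) = ≤-trans (0≤totalCost S) (≤-reflexive eq)

    minimum-[] : IsMinimumCost [] 0#
    minimum-[] = ([] , ([] , []) , refl) , λ S _ → 0≤totalCost S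

    add-set : ∀ s S → Unique S → ∃[ S′ ] Unique S′ × s ∈ S′ × S ⊆ S′ × totalCost S′ ≤ totalCost S ⊕ 1#
    add-set s S S! with s ∈? S
    ... | yes s∈S = S , S! , s∈S , (λ z → z) , ≤-addʳ 0≤1 ≤-refl
    ... | no  s∉S = s ∷ S , All.¬Any⇒All¬ S s∉S ∷ S! , here ≡.refl , there ,
                    ≤-trans (+-monoˡ-≤ _ (cost-upper s)) (≤-reflexive (+-comm _ _))

    -- A cover of the updated universe, together with one set containing the
    -- deleted element, covers the universe before the update.
    minimum-decrease : ∀ {n U u opt opt′} → DistinctNames U → Legal n U u →
                       IsMinimumCost U opt → IsMinimumCost (applyUpdate u U) opt′ → opt ≤ opt′ ⊕ 1#
    minimum-decrease _ (insert _ _ _ _) (_ , lower) ((S , (S! , _ ∷ cov) , eq) , _) =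
      ≤-addʳ 0≤1 (≤-trans (lower S (S! , cov)) (≤-reflexive eq))
    minimum-decrease {U = U} U! (delete e∈) ((_ , (_ , covT) , _) , lower) ((S , (S! , cov) , eq) , _)
      with ∈-map⁻ proj₁ e∈
    ... | y , y∈U , ≡.refl with find (All.lookup covT y∈U)
    ...   | s , s∈y , _ with add-set s S S!
    ...     | S′ , S′! , s∈S′ , S⊆S′ , cost≤ =
      ≤-trans (lower S′ (S′! , All.tabulate covered)) (≤-trans cost≤ (+-monoˡ-≤ 1# (≤-reflexive eq)))
      where
      covered : ∀ {x} → x ∈ U → Any (_∈ S′) (proj₂ x)
      covered {x} x∈U with proj₁ x ℕ.≟ proj₁ y
      ... | no x≢y = Any.map S⊆S′ (All.lookup cov (∈-filter⁺ (λ z → ¬? (proj₁ z ℕ.≟ proj₁ y)) x∈U x≢y))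
      ... | yes x≡y with name-injective U! x∈U y∈U x≡y
      ...   | ≡.refl = lose s∈y s∈S′

  -- The cost invariant of a phase.

  module Analysis {α C ζ : Carrier} (r : ℕ) (1≤α : 1# ≤ α) (1≤C : 1# ≤ C) (0≤ζ : 0# ≤ ζ)
    (2ζ≤1 : fromℕ 2 ⊛ ζ ≤ 1#) (6αC≤rζ : fromℕ 6 ⊛ (α ⊛ C) ≤ fromℕ r ⊛ ζ)
    {m : ℕ} (w : Costs F C m) where
    open Costs w
    open CoverCosts 1≤C w
    open Estimates {r = fromℕ r} 1≤α 1≤C 0≤ζ 2ζ≤1 6αC≤rζ (0≤fromℕ r)

    -- o is the optimum when the snapshot was taken, ℓ the number of updates
    -- since then, and opt the optimum now.
    record Budget (o opt : Carrier) (ℓ : ℕ) (b : Buffers m) : Set ℓ₂ where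
      field
        drift      : o ≤ opt ⊕ fromℕ ℓ
        transition : totalCost (outdated b) ⊕ (totalCost (pending b) ⊕ totalCost (current b))
                     ≤ α ⊛ (fromℕ 2 ⊛ o ⊕ fromℕ 2 ⊛ ζ ⊛ o ⊕ fromℕ 3) ⊕ fromℕ ℓ
        target     : totalCost (pending b) ⊕ totalCost (current b) ≤ α ⊛ o ⊕ fromℕ ℓ

    open Budget

    -- j updates have each paid for r steps of the phase, and the steps that
    -- remain are those of b.
    Work : Carrier → ℕ → Buffers m → Set ℓ₂
    Work o j b = fromℕ (remaining b ℕ.+ j ℕ.* r) ≤ fromℕ 3 ⊛ (α ⊛ C) ⊛ (o ⊕ 1#)

    -- A busy phase has been paid for by the `ℓ` updates since the snapshot and by the one that took
    -- it, hence `suc ℓ`. A settled phase can forget its snapshot: the next phase starts from the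
    -- cost alone.
    data Phase (opt : Carrier) : Buffers m → Set (c ⊔ ℓ₂) where
      settled   : ∀ {c} → totalCost c ≤ α ⊛ (opt ⊕ fromℕ 2 ⊛ ζ ⊛ opt) → Phase opt (buffers [] [] c)
      migrating : ∀ {o ℓ b} → ¬ Idle b → Budget o opt ℓ b → Work o (suc ℓ) b → Phase opt b

    extend-cost : ∀ u S → totalCost (extend u S) ≤ totalCost S ⊕ 1#
    extend-cost (insert _ (s ∷ _)) S = ≤-trans (+-monoˡ-≤ _ (cost-upper s)) (≤-reflexive (+-comm 1# _))
    extend-cost (insert _ [])      S = ≤-addʳ 0≤1 ≤-refl
    extend-cost (delete _)         S = ≤-addʳ 0≤1 ≤-refl

    register-idle : ∀ {u : Update m} {b} → Idle (register u b) → Idle b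
    register-idle {b = buffers [] [] c} _ = idle

    budget-register : ∀ {o opt opt′ ℓ} u b → opt ≤ opt′ ⊕ 1# → Budget o opt ℓ b →
                      Budget o opt′ (suc ℓ) (register u b)
    budget-register {o} {opt} {opt′} {ℓ} u b opt≤ B = record
      { drift = begin
          o                             ≤⟨ drift B ⟩
          opt ⊕ fromℕ ℓ                 ≤⟨ +-monoˡ-≤ _ opt≤ ⟩
          opt′ ⊕ 1# ⊕ fromℕ ℓ           ≈⟨ +-assoc opt′ 1# _ ⟩
          opt′ ⊕ (1# ⊕ fromℕ ℓ)         ∎
      ; transition = ≤-certificate (+-mono-≤ (transition B) (extend-cost u (current b)))
          (solve 6 (λ x y z z′ k l → (x :+ (y :+ z′)) :+ ((k :+ l) :+ (z :+ con 1))
              := (k :+ (con 1 :+ l)) :+ ((x :+ (y :+ z)) :+ z′)) refl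
            (totalCost (outdated b)) (totalCost (pending b)) (totalCost (current b)) (totalCost (extend u (current b))) _ _)
      ; target = ≤-certificate (+-mono-≤ (target B) (extend-cost u (current b)))
          (solve 5 (λ y z z′ k l → (y :+ z′) :+ ((k :+ l) :+ (z :+ con 1))
              := (k :+ (con 1 :+ l)) :+ ((y :+ z) :+ z′)) refl
            (totalCost (pending b)) (totalCost (current b)) (totalCost (extend u (current b))) _ _)
      }

    budget-advance : ∀ {o opt ℓ} b → Budget o opt ℓ b → Budget o opt ℓ (advance b)
    budget-advance (buffers [] [] c) B = B
    budget-advance (buffers [] (s ∷ o) c) B = record
      { drift      = drift B
      ; transition = ≤-trans (+-monoˡ-≤ _ (≤-trans (≤-addʳ (0≤cost s) ≤-refl) (≤-reflexive (+-comm _ _)))) (transition B)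
      ; target     = target B
      }
    budget-advance (buffers (s ∷ p) o c) B = record
      { drift      = drift B
      ; transition = ≤-trans (≤-reflexive (+-congˡ swap)) (transition B)
      ; target     = ≤-trans (≤-reflexive swap) (target B)
      }
      where
      swap : totalCost p ⊕ (cost s ⊕ totalCost c) ≈ cost s ⊕ totalCost p ⊕ totalCost c
      swap = solve 3 (λ p s c → p :+ (s :+ c) := s :+ p :+ c) refl _ _ _

    -- Describes the moment at which the present update has been registered but has not yet paid for
    -- its steps. This is why `Budget` and `Work` share the same `ℓ` here.
    launch-phase : ∀ {opt opt′ S} u b → 0# ≤ opt′ → opt ≤ opt′ ⊕ 1# → totalCost S ≤ α ⊛ opt′ → Phase opt b →
      ∃[ o ] ∃[ ℓ ] Budget o opt′ ℓ (new-phase S (register u b)) × Work o ℓ (new-phase S (register u b))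
    launch-phase {opt} {opt′} {S} u _ 0≤opt′ opt≤ S≤ (settled {c} c≤) =
      opt′ , 0 , record
        { drift      = ≤-addʳ ≤-refl ≤-refl
        ; transition = begin
            totalCost (extend u c) ⊕ (totalCost S ⊕ 0#) ≈⟨ +-congˡ (+-identityʳ _) ⟩
            totalCost (extend u c) ⊕ totalCost S        ≤⟨ total≤ ⟩
            _                                           ≈⟨ +-identityʳ _ ⟨
            _                                           ∎
        ; target     = +-mono-≤ S≤ ≤-refl
        }
      , (begin
        fromℕ (length S ℕ.+ length (extend u c) ℕ.+ 0)    ≡⟨ ≡.cong fromℕ (ℕ.+-identityʳ (length S ℕ.+ length (extend u c))) ⟩
        fromℕ (length S ℕ.+ length (extend u c))          ≈⟨ fromℕ-+ (length S) (length (extend u c)) ⟩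
        fromℕ (length S) ⊕ fromℕ (length (extend u c))    ≤⟨ +-mono-≤ (length≤C*totalCost S) (length≤C*totalCost (extend u c)) ⟩
        C ⊛ totalCost S ⊕ C ⊛ totalCost (extend u c)      ≈⟨ solve 3 (λ C x y → C :* x :+ C :* y := C :* (y :+ x)) refl C _ _ ⟩
        C ⊛ (totalCost (extend u c) ⊕ totalCost S)        ≤⟨ initial-work 0≤opt′ total≤ ⟩
        fromℕ 3 ⊛ (α ⊛ C) ⊛ (opt′ ⊕ 1#)         ∎)
      where
      total≤ : totalCost (extend u c) ⊕ totalCost S ≤ α ⊛ (fromℕ 2 ⊛ opt′ ⊕ fromℕ 2 ⊛ ζ ⊛ opt′ ⊕ fromℕ 3)
      total≤ = initial-cost (≤-trans (extend-cost u c) (+-monoˡ-≤ _ c≤)) opt≤ S≤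
    launch-phase {opt} {opt′} {S} u b 0≤opt′ opt≤ S≤ (migrating {o} {ℓ} busy B work)
      -- Registering touches `current` only, so a busy phase stays busy with the same number of
      -- remaining steps.
      rewrite new-phase-busy S {register u b} (busy ∘ register-idle {u} {b}) =
      o , suc ℓ , budget-register u b opt≤ B , work

    -- The steps already paid for are part of the total work. Allowing `2j` instead of `j` for the
    -- drift makes room for the 1 in `o ⊕ 1#` as soon as `j ≥ 1`.
    elapsed-bound : ∀ {o opt j b} → 0# ≤ opt → Work o j b → o ⊕ 1# ≤ opt ⊕ fromℕ 2 ⊛ fromℕ j → fromℕ j ≤ ζ ⊛ opt
    elapsed-bound {o} {opt} {j} {b} 0≤opt work o+1≤ = drift-bound 0≤opt (0≤fromℕ j) (begin
      fromℕ r ⊛ fromℕ j                  ≈⟨ *-comm _ _ ⟩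
      fromℕ j ⊛ fromℕ r                  ≈⟨ fromℕ-* j r ⟨
      fromℕ (j ℕ.* r)                    ≤⟨ fromℕ-mono (ℕ.m≤n+m _ (remaining b)) ⟩
      fromℕ (remaining b ℕ.+ j ℕ.* r)    ≤⟨ work ⟩
      fromℕ 3 ⊛ (α ⊛ C) ⊛ (o ⊕ 1#)       ≤⟨ *-monoˡ-≤ (*-nonNeg (0≤fromℕ 3) (*-nonNeg 0≤α 0≤C)) o+1≤ ⟩
      fromℕ 3 ⊛ (α ⊛ C) ⊛ (opt ⊕ fromℕ 2 ⊛ fromℕ j) ∎)

    advances-phase : ∀ {o opt ℓ} b → 0# ≤ opt → Budget o opt ℓ b → Work o ℓ b → Phase opt (advances r b)
    advances-phase {o} {opt} {ℓ} b 0≤opt B work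
      with idle? (advances r b) | advances-preserve (Budget o opt ℓ) budget-advance r b B | remaining-busy r b
    -- A phase that is still busy has used all `r` steps, so exactly `r` passes from the remaining
    -- steps to the paid ones.
    ... | no busy | B′ | rem = migrating busy B′ (≤-trans (≤-reflexive (reflexive (≡.cong fromℕ
      (≡.trans (≡.sym (ℕ.+-assoc (remaining (advances r b)) r _)) (≡.cong (ℕ._+ ℓ ℕ.* r) (rem busy)))))) work)
    ... | yes i | B′ | _ with advances r b | i
    ...   | _ | idle {c} = settled (settled-cost (0≤fromℕ ℓ)
              (≤-trans (≤-reflexive (sym (+-identityˡ _))) (target B′)) (drift B′) (ℓ≤ ℓ work (drift B)))
      where
      ℓ≤ : ∀ ℓ → Work o ℓ b → o ≤ opt ⊕ fromℕ ℓ → fromℕ ℓ ≤ ζ ⊛ opt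
      -- The phase ends within the update that started it: nothing has drifted, and `opt` may be
      -- arbitrarily small.
      ℓ≤ zero    _    _  = *-nonNeg 0≤ζ 0≤opt
      ℓ≤ (suc k) work o≤ = elapsed-bound {j = suc k} {b = b} 0≤opt work (≤-certificate
        (+-mono-≤ o≤ (0≤fromℕ k))
        (solve 3 (λ o opt k → (o :+ con 1) :+ ((opt :+ (con 1 :+ k)) :+ k)
                              := (opt :+ numeral 2 :* (con 1 :+ k)) :+ (o :+ con 0)) refl o opt (fromℕ k)))

    phase-cost : ∀ {opt} b → 0# ≤ opt → Phase opt b →
                 totalCost (current b ++ outdated b) ≤ (fromℕ 2 ⊕ fromℕ 6 ⊛ ζ) ⊛ α ⊛ opt
    phase-cost {opt} _ 0≤opt (settled {c} c≤) = begin
      totalCost (c ++ [])    ≡⟨ ≡.cong totalCost (List.++-identityʳ c) ⟩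
      totalCost c            ≤⟨ c≤ ⟩
      _                      ≤⟨ settled-ratio 0≤opt ⟩
      (fromℕ 2 ⊕ fromℕ 6 ⊛ ζ) ⊛ α ⊛ opt ∎
    phase-cost {opt} b 0≤opt (migrating {o} {ℓ} busy B work) = begin
      totalCost (current b ++ outdated b)                ≈⟨ totalCost-++ (current b) (outdated b) ⟩
      totalCost (current b) ⊕ totalCost (outdated b)     ≤⟨ ≤-addʳ (0≤totalCost (pending b)) ≤-refl ⟩
      totalCost (current b) ⊕ totalCost (outdated b) ⊕ totalCost (pending b)
        ≈⟨ solve 3 (λ c o p → c :+ o :+ p := o :+ (p :+ c)) refl (totalCost (current b)) _ _ ⟩
      totalCost (outdated b) ⊕ (totalCost (pending b) ⊕ totalCost (current b)) ≤⟨ transition-cost (0≤fromℕ ℓ) (transition B) (drift B) elapsed ⟩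
      (fromℕ 2 ⊕ fromℕ 6 ⊛ ζ) ⊛ α ⊛ opt ∎
      where
      elapsed : 1# ⊕ fromℕ ℓ ≤ ζ ⊛ opt
      elapsed = elapsed-bound {j = suc ℓ} {b = b} 0≤opt work (≤-certificate
        (+-mono-≤ (drift B) (≤-addʳ (0≤fromℕ ℓ) 0≤1))
        (solve 3 (λ o opt l → (o :+ con 1) :+ ((opt :+ l) :+ (con 1 :+ l))
                              := (opt :+ numeral 2 :* (con 1 :+ l)) :+ (o :+ con 0)) refl o opt (fromℕ ℓ)))

  -- The invariant of an execution.

  module Reduction {a : Level} {α C ζ : Carrier} (r : ℕ) (1≤α : 1# ≤ α) (1≤C : 1# ≤ C) (0≤ζ : 0# ≤ ζ)
    (2ζ≤1 : fromℕ 2 ⊛ ζ ≤ 1#) (6αC≤rζ : fromℕ 6 ⊛ (α ⊛ C) ≤ fromℕ r ⊛ ζ)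
    {m n : ℕ} (w : Costs F C m) (A : Algorithm a m) (approximate : MaintainsApproximate F w n α A) where
    open Costs w
    open Analysis r 1≤α 1≤C 0≤ζ 2ζ≤1 6αC≤rζ w
    open CoverCosts 1≤C w
    open Simulation A
    open Semantics A
    open Configuration

    -- The time `τ` is compared with that of the black box on the same `k` updates as a whole,
    -- because an amortized bound speaks only about entire executions.
    record Invariant (k τ : ℕ) (U : Universe m) (γ : Configuration) : Set (a ⊔ c ⊔ ℓ₁ ⊔ ℓ₂) where
      field
        {τ′}       : ℕ
        execution  : Execution A n k τ′ U (blackBox γ)
        τ≤         : τ ℕ.≤ τ′ ℕ.+ k ℕ.* overhead r
        distinct   : DistinctNames U
        {opt}      : Carrier
        minimum    : IsMinimumCost U opt
        {b}        : Buffers m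
        represents : Represents γ b
        guarded    : Guarded U b
        phase      : Phase opt b

    open Invariant

    invariant : ∀ {k τ U γ} → Execution (reduction r ⟨ A ⟩) n k τ U γ → Invariant k τ U γ
    invariant start = record
      { execution  = start
      ; τ≤         = z≤n
      ; distinct   = []
      ; minimum    = minimum-[]
      ; b          = buffers [] [] []
      ; represents = record
        { pending-list  = ≡.refl
        ; outdated-list = ≡.refl
        ; current-list  = ≡.refl
        ; tracks        = record
          { counter         = λ _ → ≡.refl
          ; output-unique   = []
          ; output-positive = λ ()
          ; output-complete = λ 0≢0 → contradiction ≡.refl 0≢0
          }
        }
      ; guarded    = record { target-covers = [] ; current-covers = inj₁ ≡.refl }
      ; phase      = settled (≤-reflexive (solve 2 (λ α ζ → con 0 := α :* (con 0 :+ numeral 2 :* ζ :* con 0)) refl α ζ))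
      }
    invariant (_▻_ {k} {τ} {U} {γ} {u} exec legal) =
      let I = invariant exec
          -- The black box's guarantee also supplies the optimum of the updated universe.
          (S! , S-covers) , opt′ , minimum′ , S≤ = approximate (execution I) legal
          0≤opt′ = 0≤minimum minimum′
          o , ℓ , budget , work = launch-phase u (b I) 0≤opt′
            (minimum-decrease (distinct I) legal (minimum I) minimum′) S≤ (phase I)
      in record
        { execution  = ≡.subst (Execution A n _ _ _) (≡.sym (reduction-blackBox r γ u)) (execution I ▻ legal)
        ; τ≤         = time-bound {k = k} {overhead r} (τ≤ I) (reduction-time r γ u)
        ; distinct   = distinctNames-update (distinct I) legal
        ; minimum    = minimum′
        ; represents = reduction-represents r u legal (represents I)
        ; guarded    = advances-preserve (Guarded _) guarded-advance r _
            (guarded-new-phase _ S-covers (guarded-register (b I) legal (guarded I)))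
        ; phase      = advances-phase _ 0≤opt′ budget work
        }
      where
      time-bound : ∀ {k D τ τ′ t t′} → τ ℕ.≤ τ′ ℕ.+ k ℕ.* D → t ℕ.≤ t′ ℕ.+ D → τ ℕ.+ t ℕ.≤ τ′ ℕ.+ t′ ℕ.+ suc k ℕ.* D
      time-bound {k} {D} {τ} {τ′} {t} {t′} τ≤ t≤ = ℕ.≤-trans (ℕ.+-mono-≤ τ≤ t≤) (ℕ.≤-reflexive
        (≡.trans (interchange τ′ (k ℕ.* D) t′ D) (≡.cong (τ′ ℕ.+ t′ ℕ.+_) (ℕ.+-comm (k ℕ.* D) D))))

    maintains : MaintainsApproximate F w n ((fromℕ 2 ⊕ fromℕ 6 ⊛ ζ) ⊛ α) (reduction r ⟨ A ⟩)
    maintains exec legal =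
        ( output-unique (tracks (represents I))
        , covers-mono (represented-⊇ (represents I)) (guarded-covers (b I) (guarded I)) )
      , opt I , minimum I
      , ≤-trans (totalCost-⊆ (output-unique (tracks (represents I))) (represented-⊆ (represents I)))
          (phase-cost (b I) (0≤minimum (minimum I)) (phase I))
      where I = invariant (exec ▻ legal)

    recourse : ∀ {k τ U γ u} → Execution (reduction r ⟨ A ⟩) n k τ U γ → Legal n U u →
               changes (output γ) (output (proj₁ (run (reduction r) u γ))) ℕ.≤ overhead r
    recourse {γ = γ} {u} exec _ = reduction-changes r γ u (output-unique (tracks (represents (invariant exec))))

    amortized : ∀ {X} T → fromℕ (overhead r) ≤ X → AmortizedTime F n A T →
                AmortizedTime F n (reduction r ⟨ A ⟩) (T ⊕ X)
    amortized {X} T D≤X amortizedA {k} {τ} exec = begin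
      fromℕ τ                                    ≤⟨ fromℕ-mono (τ≤ I) ⟩
      fromℕ (τ′ I ℕ.+ k ℕ.* D)                   ≈⟨ fromℕ-+ (τ′ I) (k ℕ.* D) ⟩
      fromℕ (τ′ I) ⊕ fromℕ (k ℕ.* D)             ≈⟨ +-congˡ (fromℕ-* k D) ⟩
      fromℕ (τ′ I) ⊕ fromℕ k ⊛ fromℕ D           ≤⟨ +-mono-≤ (amortizedA (execution I)) (*-monoˡ-≤ (0≤fromℕ k) D≤X) ⟩
      fromℕ k ⊛ T ⊕ fromℕ k ⊛ X                  ≈⟨ distribˡ (fromℕ k) T X ⟨
      fromℕ k ⊛ (T ⊕ X)                          ∎
      where
      I = invariant exec
      D = overhead r

    worstCase : ∀ {X} T → fromℕ (overhead r) ≤ X → WorstCaseTime F n A T →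
                WorstCaseTime F n (reduction r ⟨ A ⟩) (T ⊕ X)
    worstCase {X} T D≤X worstCaseA {σ = γ} {u} exec legal = begin
      fromℕ (proj₂ (run (reduction r) u γ))      ≤⟨ fromℕ-mono (reduction-time r γ u) ⟩
      fromℕ (time ℕ.+ overhead r)          ≈⟨ fromℕ-+ time (overhead r) ⟩
      fromℕ time ⊕ fromℕ (overhead r)       ≤⟨ +-mono-≤ (worstCaseA (execution (invariant exec)) legal) D≤X ⟩
      T ⊕ X                                      ∎
      where time = Algorithm.time A (blackBox γ) u

  -- The choice of `ζ` and of the speed.

  module Parameters {ε α C : Carrier} (0<ε : 0# ≺ ε) (ε≤2⁻¹ : ε ≤ fromℕ 2 ⁻¹) (2≤α : fromℕ 2 ≤ α) (1≤C : 1# ≤ C) where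

    private
      ε≉0 : ¬ (ε ≈ 0#)
      ε≉0 ε≈0 = proj₂ 0<ε (sym ε≈0)

      0≤ε : 0# ≤ ε
      0≤ε = proj₁ 0<ε

      1≤2 : 1# ≤ fromℕ 2
      1≤2 = ≤-addʳ (0≤fromℕ 1) ≤-refl

      ε≤1 : ε ≤ 1#
      ε≤1 = begin
        ε                 ≤⟨ ε≤2⁻¹ ⟩
        fromℕ 2 ⁻¹        ≈⟨ *-identityˡ _ ⟨
        1# ⊛ fromℕ 2 ⁻¹   ≤⟨ *-monoʳ-≤ (⁻¹-nonNeg (0≤fromℕ 2) (fromℕ≉0 1)) 1≤2 ⟩
        fromℕ 2 ⊛ fromℕ 2 ⁻¹ ≈⟨ ⁻¹-inverseʳ _ (fromℕ≉0 1) ⟩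
        1#                ∎

      0≤ε⁻¹ : 0# ≤ ε ⁻¹
      0≤ε⁻¹ = ⁻¹-nonNeg 0≤ε ε≉0

    1≤α : 1# ≤ α
    1≤α = ≤-trans 1≤2 2≤α

    ratio : Carrier
    ratio = α ⊛ C ⊛ ε ⁻¹

    1≤ratio : 1# ≤ ratio
    1≤ratio = begin
      1#              ≈⟨ ⁻¹-inverseʳ ε ε≉0 ⟨
      ε ⊛ ε ⁻¹        ≤⟨ *-monoʳ-≤ 0≤ε⁻¹ ε≤1 ⟩
      1# ⊛ ε ⁻¹       ≤⟨ *-monoʳ-≤ 0≤ε⁻¹ 1≤αC ⟩
      α ⊛ C ⊛ ε ⁻¹    ∎
      where
      1≤αC : 1# ≤ α ⊛ C
      1≤αC = begin
        1#       ≤⟨ 1≤C ⟩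
        C        ≈⟨ *-identityˡ C ⟨
        1# ⊛ C   ≤⟨ *-monoʳ-≤ (≤-trans 0≤1 1≤C) 1≤α ⟩
        α ⊛ C    ∎

    ζ : Carrier
    ζ = ε ⊛ fromℕ 6 ⁻¹

    6ζ≈ε : fromℕ 6 ⊛ ζ ≈ ε
    6ζ≈ε = trans (solve 3 (λ s ε i → s :* (ε :* i) := ε :* (s :* i)) refl (fromℕ 6) ε (fromℕ 6 ⁻¹))
      (trans (*-congˡ (⁻¹-inverseʳ _ (fromℕ≉0 5))) (*-identityʳ ε))

    0≤ζ : 0# ≤ ζ
    0≤ζ = *-nonNeg 0≤ε (⁻¹-nonNeg (0≤fromℕ 6) (fromℕ≉0 5))

    2ζ≤1 : fromℕ 2 ⊛ ζ ≤ 1#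
    2ζ≤1 = begin
      fromℕ 2 ⊛ ζ  ≤⟨ *-monoʳ-≤ 0≤ζ (fromℕ-mono {2} {6} (s≤s (s≤s z≤n))) ⟩
      fromℕ 6 ⊛ ζ  ≈⟨ 6ζ≈ε ⟩
      ε            ≤⟨ ε≤1 ⟩
      1#           ∎

    private
      -- 36 = 6 · 6: the estimates need r ⊛ ζ ≥ 6αC and lose 6ζ = ε.
      speed-ceiling : ∃[ k ] fromℕ 36 ⊛ ratio ≤ fromℕ k × fromℕ k ≤ fromℕ 36 ⊛ ratio ⊕ 1#
      speed-ceiling = ceiling _ (*-nonNeg (0≤fromℕ 36) (≤-trans 0≤1 1≤ratio))

    speed : ℕ
    speed = proj₁ speed-ceiling

    6αC≤speed*ζ : fromℕ 6 ⊛ (α ⊛ C) ≤ fromℕ speed ⊛ ζ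
    6αC≤speed*ζ = begin
      fromℕ 6 ⊛ (α ⊛ C)                     ≈⟨ *-identityʳ _ ⟨
      fromℕ 6 ⊛ (α ⊛ C) ⊛ 1#                ≈⟨ *-congˡ (⁻¹-inverseʳ ε ε≉0) ⟨
      fromℕ 6 ⊛ (α ⊛ C) ⊛ (ε ⊛ ε ⁻¹)        ≈⟨ *-congˡ (*-congʳ 6ζ≈ε) ⟨
      fromℕ 6 ⊛ (α ⊛ C) ⊛ (fromℕ 6 ⊛ ζ ⊛ ε ⁻¹) ≈⟨ solve 3 (λ b z i → numeral 6 :* b :* (numeral 6 :* z :* i) := numeral 36 :* (b :* i) :* z) refl (α ⊛ C) ζ (ε ⁻¹) ⟩
      fromℕ 36 ⊛ ratio ⊛ ζ                  ≤⟨ *-monoʳ-≤ 0≤ζ (proj₁ (proj₂ speed-ceiling)) ⟩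
      fromℕ speed ⊛ ζ                       ∎

    -- As `ratio` is at least 1, it absorbs both `c₀` and the rounding of `speed`, which turns 36
    -- into 37.
    linear-in-speed : ∀ c₀ c₁ → fromℕ (c₀ ℕ.+ speed ℕ.* c₁) ≤ fromℕ (c₀ ℕ.+ 37 ℕ.* c₁) ⊛ ratio
    linear-in-speed c₀ c₁ = begin
      fromℕ (c₀ ℕ.+ speed ℕ.* c₁)             ≈⟨ fromℕ-+ c₀ (speed ℕ.* c₁) ⟩
      fromℕ c₀ ⊕ fromℕ (speed ℕ.* c₁)         ≈⟨ +-congˡ (fromℕ-* speed c₁) ⟩
      fromℕ c₀ ⊕ fromℕ speed ⊛ fromℕ c₁       ≤⟨ +-mono-≤ c₀≤ (*-monoʳ-≤ (0≤fromℕ c₁) speed≤) ⟩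
      fromℕ c₀ ⊛ ratio ⊕ fromℕ 37 ⊛ ratio ⊛ fromℕ c₁ ≈⟨ solve 4 (λ x y z w → x :* z :+ y :* z :* w := (x :+ y :* w) :* z) refl (fromℕ c₀) (fromℕ 37) ratio (fromℕ c₁) ⟩
      (fromℕ c₀ ⊕ fromℕ 37 ⊛ fromℕ c₁) ⊛ ratio ≈⟨ *-congʳ (+-congˡ (fromℕ-* 37 c₁)) ⟨
      (fromℕ c₀ ⊕ fromℕ (37 ℕ.* c₁)) ⊛ ratio  ≈⟨ *-congʳ (fromℕ-+ c₀ (37 ℕ.* c₁)) ⟨
      fromℕ (c₀ ℕ.+ 37 ℕ.* c₁) ⊛ ratio        ∎
      where
      c₀≤ : fromℕ c₀ ≤ fromℕ c₀ ⊛ ratio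
      c₀≤ = ≤-trans (≤-reflexive (sym (*-identityʳ _))) (*-monoˡ-≤ (0≤fromℕ c₀) 1≤ratio)

      speed≤ : fromℕ speed ≤ fromℕ 37 ⊛ ratio
      speed≤ = ≤-trans (≤-trans (proj₂ (proj₂ speed-ceiling)) (+-monoʳ-≤ _ 1≤ratio))
        (≤-reflexive (solve 1 (λ x → numeral 36 :* x :+ x := numeral 37 :* x) refl ratio))

theorem1 : ∀ {c ℓ₁ ℓ₂ a : Level} →
    Σ[ K ∈ ℕ ]
    ∀ (F : ArchimedeanOrderedField c ℓ₁ ℓ₂) →
    let open ArchimedeanOrderedField F in
    ∀ (ε α C : Carrier) →
    0# ≺ ε → ε ≤ fromℕ 2 ⁻¹ →
    fromℕ 2 ≤ α →
    1# ≤ C →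
    Σ[ P ∈ Program ]
    ∀ (m n : ℕ) (w : Costs F C m) (ALG : Algorithm a m) →
    MaintainsApproximate F w n α ALG →
    MaintainsApproximate F w n ((fromℕ 2 ⊕ ε) ⊛ α) (P ⟨ ALG ⟩)
    × WorstCaseRecourse F n (P ⟨ ALG ⟩) (fromℕ K ⊛ (α ⊛ C ⊛ ε ⁻¹))
    × (∀ (T : Carrier) → AmortizedTime F n ALG T →
    AmortizedTime F n (P ⟨ ALG ⟩) (T ⊕ fromℕ K ⊛ (α ⊛ C ⊛ ε ⁻¹)))
    × (∀ (T : Carrier) → WorstCaseTime F n ALG T →
    WorstCaseTime F n (P ⟨ ALG ⟩) (T ⊕ fromℕ K ⊛ (α ⊛ C ⊛ ε ⁻¹)))
theorem1 = setup ℕ.+ 37 ℕ.* per-step , λ F ε α C 0<ε ε≤2⁻¹ 2≤α 1≤C →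
  let open ArchimedeanOrderedField F
      open OrderedField F
      open Field F
      open Parameters 0<ε ε≤2⁻¹ 2≤α 1≤C
  in reduction speed , λ m n w ALG approximate →
    let open Reduction speed 1≤α 1≤C 0≤ζ 2ζ≤1 6αC≤speed*ζ w ALG approximate
        overhead≤ = linear-in-speed setup per-step
    in
      (λ exec legal → let cover , opt , minimum , cost≤ = maintains exec legal in
        cover , opt , minimum , ≤-trans cost≤ (≤-reflexive (*-congʳ (*-congʳ (+-congˡ 6ζ≈ε)))))
    , (λ exec legal → ≤-trans (fromℕ-mono (recourse exec legal)) overhead≤)
    , (λ T → amortized T overhead≤)
    , (λ T → worstCase T overhead≤)
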